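{- Let $A,B\subseteq\Sigma^*$ with $A\neq\emptyset$. If $A$ has a recursive jump operator and $A\leq_{\mathrm m}^{\mathrm p}B$, then $B$ also has a recursive jump operator.
   Context: $\Sigma=\{0,1\}$, $\mathbb N^+$ denotes the positive integers, and $P_1,P_2,\dots$ is a standard enumeration of (deterministic) Turing transducers; $a$ is called the code of $P_a$. $A\leq_{\mathrm m}^{\mathrm p}B$ means that there is a polynomial-time computable $f:\Sigma^*\to\Sigma^*$ with $x\in A\Leftrightarrow f(x)\in B$ for all $x$. A proof system for a set $L\subseteq\Sigma^*$ is a Turing transducer that runs in polynomial time and computes a (total) function $f$ with range $\mathrm{ran}(f)=L$. (Only transducers that themselves run in polynomial time count as proof systems.) A proof system $f$ simulates a proof system $g$ if there are a total function $\pi:\Sigma^*\to\Sigma^*$ and a polynomial $p$ with $|\pi(x)|\le p(|x|)$ and $f(\pi(x))=g(x)$ for all $x\in\Sigma^*$. A jump operator for $L$ is a function $J:\mathbb N^+\to\mathbb N^+$ such that whenever $P_a$ is a proof system for $L$, $P_{J(a)}$ is a proof system for $L$ that is not simulated by $P_a$. A recursive jump operator is a jump operator that is a (total) recursive function. -}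

module Defs where

open import Level using (Level; _⊔_)
open import Data.Bool.Base using (Bool; true; false)
open import Data.Fin.Base using (Fin; zero; suc; combine; remQuot; finToFun; funToFin)
open import Data.List.Base using (List; []; _∷_; _++_; length; fromMaybe)
import Data.List.Base as List
open import Data.Maybe.Base using (Maybe; just; nothing)
import Data.Maybe.Base as Maybe
open import Data.Nat.Base using (ℕ; zero; suc; pred; _+_; _*_; _^_; _≤_; _<_; NonZero)
open import Data.Nat.DivMod using (_mod_)
open import Data.Nat.Properties using (m^n≢0)
open import Data.Product.Base using (Σ-syntax; ∃-syntax; _×_; _,_)
open import Data.Refinement using (Refinement-syntax; value)
open import Data.Vec.Base using (Vec; []; _∷_; lookup; replicate; tabulate)
import Data.Vec.Base as Vec
open import Data.Vec.Relation.Binary.Pointwise.Inductive using (Pointwise)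
open import Function.Base using (_∘_)
open import Function.Bundles using (_⇔_)
open import Relation.Binary.PropositionalEquality.Core using (_≡_)
open import Relation.Nullary.Negation.Core using (¬_)
open import Relation.Unary using (Pred; _∈_)

private
  variable
    ℓ ℓ′ : Level
    k m n : ℕ

Word : Set
Word = List Bool

ℕ⁺ : Set
ℕ⁺ = [ n ∈ ℕ ∣ NonZero n ]

-- A polynomial is given by its coefficients, constant term first.
Polynomial : Set
Polynomial = List ℕ

⟦_⟧ : Polynomial → ℕ → ℕ
⟦ [] ⟧     x = 0
⟦ c ∷ cs ⟧ x = c + x * ⟦ cs ⟧ x

------------------------------------------------------------------------
-- Turing transducers

-- `nothing` is the blank.
Symbol : Set
Symbol = Maybe Bool

data Move : Set where
  left stay right : Move

-- A two-way infinite tape; `before` lists the cells to the left of the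
-- head, nearest first, and cells beyond either list are blank.
record Tape : Set where
  constructor tape
  field
    before : List Symbol
    scan   : Symbol
    after  : List Symbol
open Tape public

emptyTape : Tape
emptyTape = tape [] nothing []

inputTape : Word → Tape
inputTape []      = emptyTape
inputTape (x ∷ w) = tape [] (just x) (List.map just w)

shift : Move → Tape → Tape
shift left  (tape []       s rs) = tape [] nothing (s ∷ rs)
shift left  (tape (l ∷ ls) s rs) = tape ls l (s ∷ rs)
shift stay  t                    = t
shift right (tape ls s [])       = tape (s ∷ ls) nothing []
shift right (tape ls s (r ∷ rs)) = tape (s ∷ ls) r rs

writeMove : Symbol × Move → Tape → Tape
writeMove (s , d) (tape ls _ rs) = shift d (tape ls s rs)

-- The machine enters state `next`, writes and moves on every tape, and
-- appends at most one bit to its write-only output.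
record Action (states tapes : ℕ) : Set where
  constructor action
  field
    next : Fin states
    acts : Vec (Symbol × Move) tapes
    emit : Maybe Bool
open Action public

-- Deterministic multi-tape transducers.  The initial state is `zero`, the
-- input is on the first tape, and the machine halts where δ is undefined.
record Transducer : Set where
  constructor transducer
  field
    extraStates extraTapes : ℕ
    δ : Fin (suc extraStates) → Vec Symbol (suc extraTapes) →
        Maybe (Action (suc extraStates) (suc extraTapes))

  states tapes : ℕ
  states = suc extraStates
  tapes  = suc extraTapes

module _ (M : Transducer) where
  open Transducer M

  record Config : Set where
    constructor config
    field
      state   : Fin states
      content : Vec Tape tapes
      output  : Word
  open Config

  initial : Word → Config
  initial w = config zero (inputTape w ∷ replicate extraTapes emptyTape) []

  perform : Config → Action states tapes → Config
  perform c α = config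
    (next α)
    (Vec.zipWith writeMove (acts α) (content c))
    (output c ++ fromMaybe (emit α))

  step : Config → Maybe Config
  step c = Maybe.map (perform c) (δ (state c) (Vec.map scan (content c)))

  -- From c, the machine halts after exactly t steps with output y.
  data HaltsIn (c : Config) : (t : ℕ) (y : Word) → Set where
    halt : step c ≡ nothing → HaltsIn c 0 (output c)
    move : ∀ {c′ t y} → step c ≡ just c′ → HaltsIn c′ t y → HaltsIn c (suc t) y

  ComputesInPolyTime : (Word → Word) → Set
  ComputesInPolyTime f = ∃[ p ] ∀ x → ∃[ t ]
    t ≤ ⟦ p ⟧ (length x) × HaltsIn (initial x) t (f x)

PolyTimeComputable : (Word → Word) → Set
PolyTimeComputable f = ∃[ M ] ComputesInPolyTime M f

------------------------------------------------------------------------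
-- The enumeration of transducers

-- The inverse of the Cantor pairing function, running along the
-- antidiagonals.
unpair : ℕ → ℕ × ℕ
unpair zero    = 0 , 0
unpair (suc n) with unpair n
... | zero  , y = suc y , 0
... | suc x , y = x , suc y

toSymbol : Fin 3 → Maybe Bool
toSymbol zero             = nothing
toSymbol (suc zero)       = just false
toSymbol (suc (suc zero)) = just true

fromSymbol : Maybe Bool → Fin 3
fromSymbol nothing      = zero
fromSymbol (just false) = suc zero
fromSymbol (just true)  = suc (suc zero)

toMove : Fin 3 → Move
toMove zero             = left
toMove (suc zero)       = stay
toMove (suc (suc zero)) = right

-- The number of possible values of the transition function (undefined, or
-- one of the actions), and the number of its arguments.
#values : (states tapes : ℕ) → ℕ
#values q k = suc (q * (9 ^ k * 3))

#arguments : (states tapes : ℕ) → ℕ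
#arguments q k = q * 3 ^ k

toAct : Fin 9 → Symbol × Move
toAct i = let s , d = remQuot {3} 3 i in toSymbol s , toMove d

toValue : Fin (#values m k) → Maybe (Action m k)
toValue             zero    = nothing
toValue {m = m} {k} (suc i) =
  let q , j = remQuot {m} (9 ^ k * 3) i
      w , e = remQuot {9 ^ k} 3 j
  in just (action q (tabulate (toAct ∘ finToFun {9} {k} w)) (toSymbol e))

fromArgument : Fin m → Vec Symbol k → Fin (#arguments m k)
fromArgument q v = combine q (funToFin (fromSymbol ∘ lookup v))

-- A transition function is read off from the digits in base `#values` of a
-- number, one digit for each argument.
toδ : ℕ → Fin m → Vec Symbol k → Maybe (Action m k)
toδ {m} {k} c q v = toValue (finToFun (c mod (V ^ N)) (fromArgument q v))
  where
  V = #values m k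
  N = #arguments m k
  instance
    V^N≢0 : NonZero (V ^ N)
    V^N≢0 = m^n≢0 V N

toTransducer : ℕ → Transducer
toTransducer c =
  let size , table = unpair c
      q , k        = unpair size
  in transducer q k (toδ table)

-- Every transducer occurs in this enumeration, up to pointwise equality of
-- transition functions.
P : ℕ⁺ → Transducer
P a = toTransducer (pred (value a))

------------------------------------------------------------------------
-- Recursive functions

data PartialRecursive : ℕ → Set where
  zeroᶠ : PartialRecursive 0
  sucᶠ  : PartialRecursive 1
  proj  : Fin n → PartialRecursive n
  comp  : PartialRecursive m → Vec (PartialRecursive n) m → PartialRecursive n
  prec  : PartialRecursive n → PartialRecursive (2 + n) → PartialRecursive (suc n)
  μ     : PartialRecursive (suc n) → PartialRecursive n

infix 4 _[_]≃_

-- φ [ xs ]≃ y : φ is defined at xs, with value y.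
data _[_]≃_ : PartialRecursive n → Vec ℕ n → ℕ → Set where
  zeroᶠ : zeroᶠ [ [] ]≃ 0
  sucᶠ  : ∀ {x} → sucᶠ [ x ∷ [] ]≃ suc x
  proj  : ∀ {i : Fin n} {xs} → proj i [ xs ]≃ lookup xs i
  comp  : ∀ {φ : PartialRecursive m} {ψs : Vec (PartialRecursive n) m} {xs ys z} →
          Pointwise (λ ψ y → ψ [ xs ]≃ y) ψs ys → φ [ ys ]≃ z →
          comp φ ψs [ xs ]≃ z
  prec₀ : ∀ {φ : PartialRecursive n} {ψ xs y} →
          φ [ xs ]≃ y → prec φ ψ [ 0 ∷ xs ]≃ y
  prec₊ : ∀ {φ : PartialRecursive n} {ψ x xs y z} →
          prec φ ψ [ x ∷ xs ]≃ y → ψ [ x ∷ y ∷ xs ]≃ z →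
          prec φ ψ [ suc x ∷ xs ]≃ z
  μ     : ∀ {φ : PartialRecursive (suc n)} {x xs} →
          φ [ x ∷ xs ]≃ 0 → (∀ {i} → i < x → ∃[ y ] φ [ i ∷ xs ]≃ suc y) →
          μ φ [ xs ]≃ x

Recursive : (ℕ⁺ → ℕ⁺) → Set
Recursive J = ∃[ φ ] ∀ a → φ [ value a ∷ [] ]≃ value (J a)

------------------------------------------------------------------------
-- Proof systems and jump operators

infix 4 _≤ₘᵖ_

_≤ₘᵖ_ : Pred Word ℓ → Pred Word ℓ′ → Set (ℓ ⊔ ℓ′)
A ≤ₘᵖ B = ∃[ f ] PolyTimeComputable f × (∀ x → x ∈ A ⇔ f x ∈ B)

-- M runs in polynomial time, the function it computes is f, and ran(f) = L.
IsProofSystem : Pred Word ℓ → Transducer → (Word → Word) → Set ℓ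
IsProofSystem L M f = ComputesInPolyTime M f × (∀ y → y ∈ L ⇔ (∃[ x ] f x ≡ y))

-- π is an arbitrary total function; it need not be computable.
Simulates : (f g : Word → Word) → Set
Simulates f g = Σ[ π ∈ (Word → Word) ] ∃[ p ]
  ∀ x → length (π x) ≤ ⟦ p ⟧ (length x) × f (π x) ≡ g x

IsJumpOperator : Pred Word ℓ → (ℕ⁺ → ℕ⁺) → Set ℓ
IsJumpOperator L J = ∀ a f → IsProofSystem L (P a) f →
  ∃[ g ] IsProofSystem L (P (J a)) g × ¬ Simulates f g

HasRecursiveJumpOperator : Pred Word ℓ → Set ℓ
HasRecursiveJumpOperator L = ∃[ J ] Recursive J × IsJumpOperator L J

-- Let r reduce A to B, let a₀ ∈ A, and let f be the proof system P_a for B.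
-- Sending ⟨u, w⟩ to u if r(u) = f(w), and to a₀ otherwise, is a proof system
-- f′ for A, whose code s(a) is computable from a.  If h is the proof system
-- with code J(s(a)), then the union g of f and r ∘ h is a proof system for B
-- whose code is again computable from a.  Were g simulated by f through π,
-- then x ↦ ⟨h(x), π(1x)⟩ would show that f′ simulates h.
--
-- The code of a transducer is a number whose digits are the values of the
-- transition function, so a construction on transducers is recursive once
-- the new digits are arithmetic functions of the old ones.  Only running a
-- given machine on the second component of a pair, the union of two machines
-- and their composition have to be uniform in this sense; the comparison of
-- r(u) with f(w) is done by one fixed machine.

module Submission where

open import Defs
open import Level using (Level)
open import Data.Bool.Base using (Bool; true; false; if_then_else_)
open import Data.Bool.Properties using () renaming (_≟_ to _≟ᵇ_)
open import Data.Fin.Base using (Fin; zero; suc; toℕ; splitAt; join; combine; remQuot; quotient; remainder; finToFun; funToFin; _↑ˡ_; _↑ʳ_)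
open import Data.Fin.Properties using (toℕ<n; toℕ-injective; toℕ-fromℕ<; toℕ-↑ˡ; toℕ-↑ʳ; splitAt-↑ˡ; splitAt-↑ʳ; splitAt-join; toℕ-combine; combine-remQuot; remQuot-combine; finToFun-funToFin; funToFin-finToFin)
open import Data.Irrelevant using ([_])
open import Data.List.Base as List using (List; []; _∷_; _++_; length; fromMaybe; _ʳ++_)
open import Data.List.Properties using (length-ʳ++; ++-assoc; ++-identityʳ; reverse-involutive)
open import Data.Maybe.Base as Maybe using (Maybe; just; nothing)
open import Data.Maybe.Properties using (map-∘; map-cong; map-id)
open import Data.Nat.Base
open import Data.Nat.Divisibility using (divides-refl)
open import Data.Nat.DivMod using (_/_; _%_; _mod_; m/n*n≤m; m≡m%n+[m/n]*n; m%n<n; m*n/n≡m; m<n⇒m/n≡0; m<n⇒m%n≡m; m%n≡m∸m/n*n; +-distrib-/-∣ˡ; [m+kn]%n≡m%n)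
open import Data.Nat.Properties
open import Data.Nat.Tactic.RingSolver using (solve-∀)
open import Data.Product.Base using (Σ-syntax; ∃-syntax; _×_; _,_; proj₁; proj₂; uncurry; map₂)
open import Data.Refinement using (value; _,_)
open import Data.Sum.Base as Sum using (_⊎_; inj₁; inj₂; [_,_]′)
open import Data.Vec.Base as Vec using (Vec; []; _∷_; lookup; tabulate; replicate; head; tail)
open import Data.Vec.Properties using (lookup∘tabulate; tabulate∘lookup; tabulate-cong; tabulate-∘; lookup-map; lookup-zipWith; lookup-replicate)
open import Data.Vec.Relation.Binary.Pointwise.Inductive using (Pointwise; []; _∷_)
open import Function.Base using (_∘_; _$_; id)
open import Function.Bundles using (_⇔_; mk⇔; Equivalence)
open import Relation.Binary.PropositionalEquality
open import Relation.Nullary using (¬_; does; yes; contradiction)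
open import Relation.Unary using (Pred; Satisfiable; _∈_)

-- No time bound is ever computed: polynomials are only shown to exist, so the new codes depend on
-- the old transition tables alone and are defined for every `a`, whether or not `P a` is a proof
-- system. The union with `f` is taken because `r ∘ h` reaches only the image of `A` under `r`,
-- which may miss part of `B`. Each uniform construction appears twice. As a `Machine`, with
-- arbitrary types of states and tapes, it gets its correctness and time bound; as an arithmetic
-- function on digits it gets its recursiveness. `Realizes` joins the two. The tape layout keeps the
-- tapes of a component in contiguous blocks, so that passing between component and whole is done by
-- quotient, remainder and multiplication by a power. Tapes on which a component does not act must
-- contribute digit 0, and the act with code 0 writes a blank and moves left. Such tapes therefore
-- pile up explicit blanks, which is why tapes are compared only up to trailing blanks.

private
  variable
    b k m n : ℕ
    X       : Set

-- Recursive functions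

-- The function is stored beside its index so that `fun` computes: a term assembled from recursive
-- pieces can then be matched with the intended arithmetic expression by `refl`.
record Rec (n : ℕ) : Set where
  constructor rec
  field
    fun      : Vec ℕ n → ℕ
    index    : PartialRecursive n
    computes : ∀ xs → index [ xs ]≃ fun xs
open Rec

var : Fin n → Rec n
var i = rec (λ xs → lookup xs i) (proj i) (λ _ → proj)

app : Rec m → Vec (Rec n) m → Rec n
app {n = n} R Ss = rec
  (λ xs → fun R (Vec.map (λ S → fun S xs) Ss))
  (comp (index R) (Vec.map index Ss))
  (λ xs → comp (arguments xs Ss) (computes R _))
  where
  arguments : ∀ xs (Ss : Vec (Rec n) m) →
    Pointwise (λ ψ y → ψ [ xs ]≃ y) (Vec.map index Ss) (Vec.map (λ S → fun S xs) Ss)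
  arguments xs []       = []
  arguments xs (S ∷ Ss) = computes S xs ∷ arguments xs Ss

sucᴿ : Rec n → Rec n
sucᴿ R = app (rec (λ xs → suc (head xs)) sucᶠ (λ { (x ∷ []) → sucᶠ })) (R ∷ [])

-- The tower of successors is stuck for a variable `c`, so `fun` is restated as the constant
-- function. This lets codes that are merely known to exist occur as constants.
lit : ℕ → Rec n
lit c = rec (λ _ → c) (index (const c)) (λ xs → subst (index (const c) [ xs ]≃_) (const-fun c xs) (computes (const c) xs))
  where
  const : ℕ → Rec n
  const zero    = app (rec (λ _ → 0) zeroᶠ (λ { [] → zeroᶠ })) []
  const (suc c) = sucᴿ (const c)

  const-fun : ∀ c xs → fun (const {n} c) xs ≡ c
  const-fun zero    xs = refl
  const-fun (suc c) xs = cong suc (const-fun c xs)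

-- The function `f` is prescribed and only checked against the recursion equations, so that `fun` is
-- the native operation, such as `_+_`, and not an unfolded recursor.
primrec : (f : ℕ → Vec ℕ n → ℕ) (R : Rec n) (S : Rec (2 + n)) →
  (∀ xs → fun R xs ≡ f 0 xs) → (∀ x xs → fun S (x ∷ f x xs ∷ xs) ≡ f (suc x) xs) →
  Rec (suc n)
primrec f R S base step = rec (λ xs → f (head xs) (tail xs)) (prec (index R) (index S)) (λ { (x ∷ xs) → go x xs })
  where
  go : ∀ x xs → prec (index R) (index S) [ x ∷ xs ]≃ f x xs
  go zero    xs = prec₀ (subst (index R [ xs ]≃_) (base xs) (computes R xs))
  go (suc x) xs = prec₊ (go x xs) (subst (index S [ _ ]≃_) (step x xs) (computes S _))

-- The index of `R` is total, so the search is defined at every smaller candidate; it passes these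
-- because their values are nonzero, and stops at `f xs`.
minimize : (f : Vec ℕ n → ℕ) (R : Rec (suc n)) →
  (∀ xs → fun R (f xs ∷ xs) ≡ 0) → (∀ xs {i} → i < f xs → ¬ fun R (i ∷ xs) ≡ 0) → Rec n
minimize f R root least = rec f (μ (index R)) λ xs →
  μ (subst (index R [ _ ]≃_) (root xs) (computes R _)) (λ {i} i< → positive xs i (least xs i<))
  where
  positive : ∀ xs i → ¬ fun R (i ∷ xs) ≡ 0 → ∃[ y ] index R [ i ∷ xs ]≃ suc y
  positive xs i ≢0 with fun R (i ∷ xs) | computes R (i ∷ xs)
  ... | zero  | _ = contradiction refl ≢0
  ... | suc y | p = y , p

infixr 8 _^ᴿ_
infixl 6 _⊕_ _⊖_
infixl 7 _⊗_ _⊘_ _mod′_ _⊙_ _÷_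

pattern #0 = zero
pattern #1 = suc zero
pattern #2 = suc (suc zero)
pattern #3 = suc (suc (suc zero))
pattern #4 = suc (suc (suc (suc zero)))
pattern #5 = suc (suc (suc (suc (suc zero))))

_⊕_ : Rec n → Rec n → Rec n
R ⊕ S = app (primrec (λ x xs → x + head xs) (var #0) (sucᴿ (var #1))
  (λ { (x ∷ []) → refl }) (λ { _ (x ∷ []) → refl })) (R ∷ S ∷ [])

_⊗_ : Rec n → Rec n → Rec n
R ⊗ S = app (primrec (λ x xs → x * head xs) (lit 0) (var #2 ⊕ var #1)
  (λ { (x ∷ []) → refl }) (λ { _ (x ∷ []) → refl })) (R ∷ S ∷ [])

predᴿ : Rec n → Rec n
predᴿ R = app (primrec (λ x _ → pred x) (lit 0) (var #0) (λ _ → refl) (λ _ _ → refl)) (R ∷ [])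

_⊖_ : Rec n → Rec n → Rec n
R ⊖ S = app (primrec (λ x xs → head xs ∸ x) (var #0) (predᴿ (var #1))
  (λ { (x ∷ []) → refl }) (λ { y (x ∷ []) → pred[m∸n]≡m∸[1+n] x y })) (S ∷ R ∷ [])

_^ᴿ_ : Rec n → Rec n → Rec n
R ^ᴿ S = app (primrec (λ x xs → head xs ^ x) (lit 1) (var #2 ⊗ var #1)
  (λ { (x ∷ []) → refl }) (λ { _ (x ∷ []) → refl })) (S ∷ R ∷ [])

if0_then_else_ : ℕ → ℕ → ℕ → ℕ
if0 zero  then a else b = a
if0 suc _ then a else b = b

-- Primitive recursion that ignores the recursive value. In the step the predecessor of the
-- condition and that value come first, which puts the second branch at `var #3`.
ifᴿ : Rec n → Rec n → Rec n → Rec n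
ifᴿ C R S = app (primrec (λ x xs → if0 x then head xs else head (tail xs)) (var #0) (var #3)
  (λ { (x ∷ y ∷ []) → refl }) (λ { _ (x ∷ y ∷ []) → refl })) (C ∷ R ∷ S ∷ [])

-- Division by 0 yields 0, so that arithmetic on codes needs no proofs of nonzeroness. Then
-- `m mod′ 0` is `m`, and quotient and remainder still recombine to `m`.
_÷_ : ℕ → ℕ → ℕ
m ÷ zero    = 0
m ÷ n@(suc _) = m / n

_mod′_ : ℕ → ℕ → ℕ
m mod′ n = m ∸ m ÷ n * n

a*n+b÷n≡a : ∀ a {n b} → b < n → (a * n + b) ÷ n ≡ a
a*n+b÷n≡a a {n@(suc _)} {b} b<n = begin
  (a * n + b) / n    ≡⟨ +-distrib-/-∣ˡ b (divides-refl a) ⟩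
  a * n / n + b / n  ≡⟨ cong₂ _+_ (m*n/n≡m a n) (m<n⇒m/n≡0 b<n) ⟩
  a + 0              ≡⟨ +-identityʳ a ⟩
  a                  ∎
  where open ≡-Reasoning

a*n+b-mod′-n≡b : ∀ a {n b} → b < n → (a * n + b) mod′ n ≡ b
a*n+b-mod′-n≡b a {n} {b} b<n =
  trans (cong (λ c → a * n + b ∸ c * n) (a*n+b÷n≡a a b<n)) (m+n∸m≡n (a * n) b)

mod′-small : ∀ {b n} → b < n → b mod′ n ≡ b
mod′-small = a*n+b-mod′-n≡b 0

%≡mod′ : ∀ m n .{{_ : NonZero n}} → m % n ≡ m mod′ n
%≡mod′ m n@(suc _) = m%n≡m∸m/n*n m n

m÷n*n+m-mod′-n≡m : ∀ m n → m ÷ n * n + m mod′ n ≡ m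
m÷n*n+m-mod′-n≡m m zero          = refl
m÷n*n+m-mod′-n≡m m n@(suc _) = m+[n∸m]≡n (m/n*n≤m m n)

-- The quotient is the least i with m < (i + 1) n; the factor n makes the
-- search end at once when n = 0.
_⊘_ : Rec n → Rec n → Rec n
R ⊘ S = app (minimize (λ xs → head xs ÷ head (tail xs))
    (var #2 ⊗ (sucᴿ (var #1) ⊖ sucᴿ (var #0) ⊗ var #2))
    (λ { (a ∷ b ∷ []) → root a b }) (λ { (a ∷ b ∷ []) → least a b }))
  (R ∷ S ∷ [])
  where
  root : ∀ a b → b * (suc a ∸ suc (a ÷ b) * b) ≡ 0
  root a zero      = refl
  root a b@(suc _) = trans (cong (b *_) (m≤n⇒m∸n≡0 a<)) (*-zeroʳ b)
    where
    open ≤-Reasoning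
    a< : suc a ≤ suc (a / b) * b
    a< = begin-strict
      a                  ≡⟨ m≡m%n+[m/n]*n a b ⟩
      a % b + a / b * b  <⟨ +-monoˡ-< (a / b * b) (m%n<n a b) ⟩
      b + a / b * b      ∎

  least : ∀ a b {i} → i < a ÷ b → ¬ b * (suc a ∸ suc i * b) ≡ 0
  least a b@(suc _) {i} i< eq = n≮n a (begin-strict
    a            <⟨ m∸n≡0⇒m≤n (m*n≡0⇒n≡0 b eq) ⟩
    suc i * b    ≤⟨ *-monoˡ-≤ b i< ⟩
    a / b * b    ≤⟨ m/n*n≤m a b ⟩
    a            ∎)
    where
    open ≤-Reasoning
    m*n≡0⇒n≡0 : ∀ m {n} .{{_ : NonZero m}} → m * n ≡ 0 → n ≡ 0
    m*n≡0⇒n≡0 (suc m) {n} e = m+n≡0⇒m≡0 n e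

_⊙_ : Rec n → Rec n → Rec n
R ⊙ S = R ⊖ R ⊘ S ⊗ S

-- Cantor pairing and the recursiveness of its inverse

triangle : ℕ → ℕ
triangle zero    = 0
triangle (suc n) = suc n + triangle n

pair : ℕ → ℕ → ℕ
pair x y = triangle (x + y) + y

-- Induction along the enumeration: the two cases are the jump from the end of one antidiagonal to
-- the start of the next, and a step along an antidiagonal.
pair-unpair : ∀ n → pair (proj₁ (unpair n)) (proj₂ (unpair n)) ≡ n
pair-unpair zero = refl
pair-unpair (suc n) with unpair n | pair-unpair n
... | zero  , y | eq = cong suc (begin
  y + 0 + triangle (y + 0) + 0  ≡⟨ arith y (triangle (y + 0)) ⟩
  triangle (y + 0) + y          ≡⟨ cong (λ z → triangle z + y) (+-identityʳ y) ⟩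
  triangle y + y                ≡⟨ eq ⟩
  n                             ∎)
  where
  open ≡-Reasoning
  arith : ∀ y t → y + 0 + t + 0 ≡ t + y
  arith = solve-∀
... | suc x , y | eq = begin
  triangle (x + suc y) + suc y      ≡⟨ cong (λ z → triangle z + suc y) (+-suc x y) ⟩
  triangle (suc (x + y)) + suc y    ≡⟨ +-suc (triangle (suc (x + y))) y ⟩
  suc (triangle (suc (x + y)) + y)  ≡⟨ cong suc eq ⟩
  suc n                             ∎
  where open ≡-Reasoning

unpair-step : ∀ n y → unpair n ≡ (0 , y) → unpair (suc n) ≡ (suc y , 0)
unpair-step n y eq with unpair n
unpair-step n y refl | .0 , .y = refl

unpair-step′ : ∀ n x y → unpair n ≡ (suc x , y) → unpair (suc n) ≡ (x , suc y)
unpair-step′ n x y eq with unpair n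
unpair-step′ n x y refl | .(suc x) , .y = refl

unpair-pair : ∀ x y → unpair (pair x y) ≡ (x , y)
unpair-pair x y = diagonal (x + y) x y refl
  where
  -- The walk is traced backwards: `(x , suc y)` comes from `(suc x , y)`, and the start of a
  -- nonzero antidiagonal from `(0 , d)` on the previous one.
  diagonal : ∀ d x y → x + y ≡ d → unpair (triangle d + y) ≡ (x , y)
  diagonal zero zero zero _ = refl
  diagonal (suc d) (suc x) zero e rewrite +-identityʳ x | suc-injective e =
    trans (cong unpair (cong suc (trans (+-identityʳ (d + triangle d)) (+-comm d (triangle d)))))
      (unpair-step (triangle d + d) d (diagonal d 0 d refl))
  diagonal d x (suc y) e =
    trans (cong unpair (+-suc (triangle d) y))
      (unpair-step′ (triangle d + y) x y (diagonal d (suc x) y (trans (sym (+-suc x y)) e)))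

triangleᴿ : Rec n → Rec n
triangleᴿ R = app (primrec (λ x _ → triangle x) (lit 0) (sucᴿ (var #0) ⊕ var #1) (λ _ → refl) (λ _ _ → refl)) (R ∷ [])

pairᴿ : Rec n → Rec n → Rec n
pairᴿ R S = triangleᴿ (R ⊕ S) ⊕ S

triangle-mono : ∀ {a b} → a ≤ b → triangle a ≤ triangle b
triangle-mono z≤n       = z≤n
triangle-mono (s≤s a≤b) = s≤s (+-mono-≤ a≤b (triangle-mono a≤b))

antidiagonal : ℕ → ℕ
antidiagonal n = proj₁ (unpair n) + proj₂ (unpair n)

-- The antidiagonal through `a` is the least `i` with `a < triangle (suc i)`. Once it is found, both
-- components of `unpair a` follow by subtraction.
antidiagonalᴿ : Rec n → Rec n
antidiagonalᴿ R = app (minimize (λ xs → antidiagonal (head xs)) (sucᴿ (var #1) ⊖ triangleᴿ (sucᴿ (var #0)))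
    (λ { (a ∷ []) → root a }) (λ { (a ∷ []) → least a })) (R ∷ [])
  where
  open ≤-Reasoning
  root : ∀ a → suc a ∸ triangle (suc (antidiagonal a)) ≡ 0
  root a = let x , y = unpair a in m≤n⇒m∸n≡0 (begin
    suc a                          ≡⟨ cong suc (pair-unpair a) ⟨
    suc (triangle (x + y) + y)     ≡⟨ cong suc (+-comm (triangle (x + y)) y) ⟩
    suc (y + triangle (x + y))     ≤⟨ s≤s (+-monoˡ-≤ (triangle (x + y)) (m≤n+m y x)) ⟩
    triangle (suc (x + y))         ∎)

  least : ∀ a {i} → i < antidiagonal a → ¬ suc a ∸ triangle (suc i) ≡ 0
  least a {i} i< eq = let x , y = unpair a in n≮n a (begin-strict
    a                    <⟨ m∸n≡0⇒m≤n eq ⟩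
    triangle (suc i)     ≤⟨ triangle-mono i< ⟩
    triangle (x + y)     ≤⟨ m≤m+n (triangle (x + y)) y ⟩
    triangle (x + y) + y ≡⟨ pair-unpair a ⟩
    a                    ∎)

withFun : (f : Vec ℕ n → ℕ) (R : Rec n) → (∀ xs → fun R xs ≡ f xs) → Rec n
withFun f R eq = rec f (index R) (λ xs → subst (index R [ xs ]≃_) (eq xs) (computes R xs))

sndᴿ : Rec n → Rec n
sndᴿ R = withFun (λ xs → proj₂ (unpair (fun R xs))) (R ⊖ triangleᴿ (antidiagonalᴿ R)) (λ xs → eq (fun R xs))
  where
  eq : ∀ a → a ∸ triangle (antidiagonal a) ≡ proj₂ (unpair a)
  eq a = trans (cong (_∸ triangle (antidiagonal a)) (sym (pair-unpair a))) (m+n∸m≡n (triangle (antidiagonal a)) _)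

fstᴿ : Rec n → Rec n
fstᴿ R = withFun (λ xs → proj₁ (unpair (fun R xs))) (antidiagonalᴿ R ⊖ sndᴿ R)
  (λ xs → m+n∸n≡m _ (proj₂ (unpair (fun R xs))))

-- Digits are reduced modulo b, and the most significant one comes first.
horner : (b : ℕ) (f : ℕ → ℕ) (n : ℕ) → ℕ
horner b f zero    = 0
horner b f (suc n) = horner b f n * b + f n mod′ b

hornerᴿ : Rec n → Rec (suc n) → Rec n → Rec n
hornerᴿ {n = n} B F N = withFun _ (app (primrec (λ x xs → horner (fun B xs) (λ i → fun F (i ∷ xs)) x) (lit 0)
    -- The recursion supplies counter, accumulated value and parameters in this order. `F` expects
    -- the counter followed by the parameters, so the accumulated value is skipped.
    (var #1 ⊗ base ⊕ app F (var #0 ∷ Vec.tabulate (λ i → var (suc (suc i)))) ⊙ base)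
    (λ _ → refl) successor)
    (N ∷ Vec.tabulate var))
  (λ xs → cong (λ ys → horner (fun B ys) (λ i → fun F (i ∷ ys)) (fun N xs)) (parameters xs))
  where
  base : Rec (2 + n)
  base = app B (Vec.tabulate (λ i → var (suc (suc i))))

  parameters : ∀ xs → Vec.map (λ S → fun S xs) (Vec.tabulate var) ≡ xs
  parameters xs = trans (sym (tabulate-∘ (λ S → fun S xs) var)) (tabulate∘lookup xs)

  digits : ℕ → Vec ℕ n → ℕ
  digits x xs = horner (fun B xs) (λ i → fun F (i ∷ xs)) x

  later : ∀ x xs → Vec.map (λ S → fun S (x ∷ digits x xs ∷ xs)) (Vec.tabulate (λ i → var (suc (suc i)))) ≡ xs
  later x xs = trans (sym (tabulate-∘ (λ S → fun S (x ∷ digits x xs ∷ xs)) (λ i → var (suc (suc i))))) (tabulate∘lookup xs)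

  successor : ∀ x xs → _ ≡ digits (suc x) xs
  successor x xs = cong (λ ys → horner (fun B xs) (λ i → fun F (i ∷ xs)) x * fun B ys + fun F (x ∷ ys) mod′ fun B ys)
    (later x xs)

-- Numbers coding transition functions

toℕ-combine′ : ∀ (i : Fin m) (j : Fin n) → toℕ (combine i j) ≡ toℕ i * n + toℕ j
toℕ-combine′ {n = n} i j = trans (toℕ-combine i j) (cong (_+ toℕ j) (*-comm n (toℕ i)))

toℕ-remQuot : ∀ n (i : Fin (m * n)) → toℕ i ≡ toℕ (quotient {m} n i) * n + toℕ (remainder {m} n i)
toℕ-remQuot {m} n i = trans (cong toℕ (sym (combine-remQuot {m} n i))) (toℕ-combine′ (quotient {m} n i) (remainder {m} n i))

toℕ-mod : ∀ a n .{{_ : NonZero n}} → toℕ (a mod n) ≡ a mod′ n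
toℕ-mod a n = trans (toℕ-fromℕ< (m%n<n a n)) (%≡mod′ a n)

-- The most significant digit comes first.
number : (Fin k → Fin b) → ℕ
number f = toℕ (funToFin f)

number< : (f : Fin k → Fin b) → number f < b ^ k
number< f = toℕ<n (funToFin f)

funToFin-cong : ∀ {f g : Fin k → Fin b} → f ≗ g → funToFin f ≡ funToFin g
funToFin-cong {zero}  eq = refl
funToFin-cong {suc k} eq = cong₂ combine (eq zero) (funToFin-cong (eq ∘ suc))

number-cong : ∀ {f g : Fin k → Fin b} → f ≗ g → number f ≡ number g
number-cong eq = cong toℕ (funToFin-cong eq)

number-∷ : ∀ (f : Fin (suc k) → Fin b) → number f ≡ toℕ (f zero) * b ^ k + number (f ∘ suc)
number-∷ f = toℕ-combine′ (f zero) (funToFin (f ∘ suc))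

-- This turns a division of the tapes into two blocks into arithmetic: the leading block is a
-- quotient by `b ^ n`, the trailing one the remainder.
number-++ : ∀ m (f : Fin (m + n) → Fin b) →
  number f ≡ number (f ∘ (_↑ˡ n)) * b ^ n + number (f ∘ (m ↑ʳ_))
number-++ zero    f = refl
number-++ {n} {b} (suc m) f = begin
  number f
    ≡⟨ number-∷ f ⟩
  f₀ * b ^ (m + n) + number (f ∘ suc)
    ≡⟨ cong₂ _+_ (cong (f₀ *_) (^-distribˡ-+-* b m n)) (number-++ m (f ∘ suc)) ⟩
  f₀ * (b ^ m * b ^ n) + (low * b ^ n + high)
    ≡⟨ cong (_+ (low * b ^ n + high)) (*-assoc f₀ (b ^ m) (b ^ n)) ⟨
  f₀ * b ^ m * b ^ n + (low * b ^ n + high)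
    ≡⟨ +-assoc (f₀ * b ^ m * b ^ n) (low * b ^ n) (high) ⟨
  f₀ * b ^ m * b ^ n + low * b ^ n + high
    ≡⟨ cong (_+ high) (*-distribʳ-+ (b ^ n) (f₀ * b ^ m) low) ⟨
  (f₀ * b ^ m + low) * b ^ n + high
    ≡⟨ cong (λ a → a * b ^ n + high) (number-∷ (f ∘ (_↑ˡ n))) ⟨
  number (f ∘ (_↑ˡ n)) * b ^ n + high
    ∎
  where
  open ≡-Reasoning
  f₀ low high : ℕ
  f₀  = toℕ (f zero)
  low = number (f ∘ suc ∘ (_↑ˡ n))
  high = number (f ∘ (suc m ↑ʳ_))

number-constant : ∀ k (d : Fin b) → toℕ d ≡ 0 → number {k} (λ _ → d) ≡ 0
number-constant zero    d d≡0 = refl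
number-constant {b} (suc k) d d≡0 = trans (number-∷ {k} (λ _ → d))
  (cong₂ (λ x y → x * b ^ k + y) d≡0 (number-constant k d d≡0))

-- For a number with `k` digits in base `b`: the remainder removes the `i` leading digits, the
-- quotient the trailing ones.
digit : (b k i x : ℕ) → ℕ
digit b k i x = (x mod′ b ^ (k ∸ i)) ÷ b ^ (k ∸ suc i)

toℕ-finToFun : ∀ (x : Fin (b ^ k)) i → toℕ (finToFun {b} {k} x i) ≡ digit b k (toℕ i) (toℕ x)
toℕ-finToFun {b} {suc k} x zero = sym (begin
  (toℕ x mod′ b ^ suc k) ÷ b ^ k                                ≡⟨ cong (_÷ b ^ k) (mod′-small (toℕ<n x)) ⟩
  toℕ x ÷ b ^ k                                                 ≡⟨ cong (_÷ b ^ k) (toℕ-remQuot {b} (b ^ k) x) ⟩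
  (toℕ (quotient {b} (b ^ k) x) * b ^ k + toℕ (remainder {b} (b ^ k) x)) ÷ b ^ k
    ≡⟨ a*n+b÷n≡a (toℕ (quotient {b} (b ^ k) x)) (toℕ<n (remainder {b} (b ^ k) x)) ⟩
  toℕ (quotient {b} (b ^ k) x)                                      ∎)
  where open ≡-Reasoning
toℕ-finToFun {b} {suc k} x (suc i) = begin
  toℕ (finToFun {b} {k} r i)                                        ≡⟨ toℕ-finToFun {b} {k} r i ⟩
  (toℕ r mod′ b ^ (k ∸ toℕ i)) ÷ b ^ (k ∸ suc (toℕ i))      ≡⟨ cong (_÷ b ^ (k ∸ suc (toℕ i))) same ⟩
  (toℕ x mod′ b ^ (k ∸ toℕ i)) ÷ b ^ (k ∸ suc (toℕ i))      ∎
  where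
  open ≡-Reasoning
  r : Fin (b ^ k)
  r = remainder {b} (b ^ k) x

  drop-multiple : ∀ c n r → (c * n + r) mod′ n ≡ r mod′ n
  drop-multiple c zero    r = cong (_+ r) (*-zeroʳ c)
  drop-multiple c n@(suc _) r = begin
    (c * n + r) mod′ n ≡⟨ %≡mod′ (c * n + r) n ⟨
    (c * n + r) % n    ≡⟨ cong (_% n) (+-comm (c * n) r) ⟩
    (r + c * n) % n    ≡⟨ [m+kn]%n≡m%n r c n ⟩
    r % n              ≡⟨ %≡mod′ r n ⟩
    r mod′ n           ∎

  -- Dropping the leading digit subtracts a multiple of `b ^ k`, hence of `b ^ (k ∸ toℕ i)`, and
  -- leaves the residue as it is.
  same : toℕ r mod′ b ^ (k ∸ toℕ i) ≡ toℕ x mod′ b ^ (k ∸ toℕ i)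
  same = begin
    toℕ r mod′ p                          ≡⟨ drop-multiple (q * b ^ toℕ i) p (toℕ r) ⟨
    (q * b ^ toℕ i * p + toℕ r) mod′ p    ≡⟨ cong (λ z → (z + toℕ r) mod′ p) (*-assoc q (b ^ toℕ i) p) ⟩
    (q * (b ^ toℕ i * p) + toℕ r) mod′ p  ≡⟨ cong (λ z → (q * z + toℕ r) mod′ p) (^-distribˡ-+-* b (toℕ i) (k ∸ toℕ i)) ⟨
    (q * b ^ (toℕ i + (k ∸ toℕ i)) + toℕ r) mod′ p
      ≡⟨ cong (λ z → (q * b ^ z + toℕ r) mod′ p) (m+[n∸m]≡n (<⇒≤ (toℕ<n i))) ⟩
    (q * b ^ k + toℕ r) mod′ p            ≡⟨ cong (_mod′ p) (toℕ-remQuot {b} (b ^ k) x) ⟨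
    toℕ x mod′ p                          ∎
    where
    p q : ℕ
    p = b ^ (k ∸ toℕ i)
    q = toℕ (quotient {b} (b ^ k) x)

-- `number` recurses on the first digit, whereas `horner` appends the last one, which is the form
-- that primitive recursion on the length produces. `front` moves the first digit of `horner` to the
-- front.
number-horner : ∀ b .{{_ : NonZero b}} k (f : ℕ → ℕ) → number {k} (λ i → f (toℕ i) mod b) ≡ horner b f k
number-horner b zero    f = refl
number-horner b (suc k) f = begin
  number {suc k} (λ i → f (toℕ i) mod b)
    ≡⟨ number-∷ {k} (λ i → f (toℕ i) mod b) ⟩
  toℕ (f 0 mod b) * b ^ k + number {k} (λ i → f (suc (toℕ i)) mod b)
    ≡⟨ cong₂ (λ x y → x * b ^ k + y) (toℕ-mod (f 0) b) (number-horner b k (f ∘ suc)) ⟩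
  f 0 mod′ b * b ^ k + horner b (f ∘ suc) k
    ≡⟨ front k f ⟨
  horner b f (suc k) ∎
  where
  open ≡-Reasoning
  front : ∀ k f → horner b f (suc k) ≡ f 0 mod′ b * b ^ k + horner b (f ∘ suc) k
  front zero f = trans (sym (*-identityʳ _)) (sym (+-identityʳ _))
  front (suc k) f = begin
    horner b f (suc k) * b + d                             ≡⟨ cong (λ z → z * b + d) (front k f) ⟩
    (f 0 mod′ b * b ^ k + horner b (f ∘ suc) k) * b + d    ≡⟨ cong (_+ d) (*-distribʳ-+ b (f 0 mod′ b * b ^ k) _) ⟩
    f 0 mod′ b * b ^ k * b + horner b (f ∘ suc) k * b + d  ≡⟨ +-assoc (f 0 mod′ b * b ^ k * b) _ d ⟩
    f 0 mod′ b * b ^ k * b + horner b (f ∘ suc) (suc k)    ≡⟨ cong (_+ horner b (f ∘ suc) (suc k)) (trans (*-assoc (f 0 mod′ b) (b ^ k) b) (cong (f 0 mod′ b *_) (*-comm (b ^ k) b))) ⟩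
    f 0 mod′ b * b ^ suc k + horner b (f ∘ suc) (suc k)    ∎
    where
    d : ℕ
    d = f (suc k) mod′ b

-- Codes of actions, and reading and writing transition tables

fromMove : Move → Fin 3
fromMove left  = zero
fromMove stay  = suc zero
fromMove right = suc (suc zero)

fromAct : Symbol × Move → Fin 9
fromAct (s , d) = combine (fromSymbol s) (fromMove d)

toSymbol-fromSymbol : ∀ s → toSymbol (fromSymbol s) ≡ s
toSymbol-fromSymbol nothing      = refl
toSymbol-fromSymbol (just false) = refl
toSymbol-fromSymbol (just true)  = refl

toAct-fromAct : ∀ a → toAct (fromAct a) ≡ a
toAct-fromAct (nothing , left)       = refl
toAct-fromAct (nothing , stay)       = refl
toAct-fromAct (nothing , right)      = refl
toAct-fromAct (just false , left)    = refl
toAct-fromAct (just false , stay)    = refl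
toAct-fromAct (just false , right)   = refl
toAct-fromAct (just true , left)     = refl
toAct-fromAct (just true , stay)     = refl
toAct-fromAct (just true , right)    = refl

symbols : (Fin k → Symbol) → ℕ
symbols v = number (fromSymbol ∘ v)

acts# : (Fin k → Symbol × Move) → ℕ
acts# w = number (fromAct ∘ w)

-- The mixed-radix layout that `toValue` decodes: next state, base-9 acts of `k` tapes, base-3
-- emission. The successor keeps 0 for an undefined transition.
valueCode : ℕ → ℕ → ℕ → ℕ → ℕ
valueCode k p w e = suc ((p * 9 ^ k + w) * 3 + e)

actionCode : Maybe (Action m k) → ℕ
actionCode nothing                        = 0
actionCode {k = k} (just (action p w e)) = valueCode k (toℕ p) (acts# (lookup w)) (toℕ (fromSymbol e))

fromValue : Maybe (Action m k) → Fin (#values m k)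
fromValue nothing               = zero
fromValue (just (action p w e)) = suc (combine p (combine (funToFin (fromAct ∘ lookup w)) (fromSymbol e)))

toValue-fromValue : (α : Maybe (Action m k)) → toValue (fromValue α) ≡ α
toValue-fromValue nothing = refl
toValue-fromValue {m} {k} (just (action p w e)) = begin
  build p′ (remQuot 3 j)        ≡⟨ cong (λ (q , j) → build q (remQuot 3 j)) (remQuot-combine p (combine u (fromSymbol e))) ⟩
  build p (remQuot 3 (combine u (fromSymbol e)))
                                ≡⟨ cong (build p) (remQuot-combine u (fromSymbol e)) ⟩
  build p (u , fromSymbol e)    ≡⟨ cong just (cong₂ (action p) acts≡ (toSymbol-fromSymbol e)) ⟩
  just (action p w e)           ∎
  where
  open ≡-Reasoning
  build : Fin m → Fin (9 ^ k) × Fin 3 → Maybe (Action m k)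
  build q (w , e) = just (action q (tabulate (toAct ∘ finToFun {9} {k} w)) (toSymbol e))

  u : Fin (9 ^ k)
  u = funToFin (fromAct ∘ lookup w)

  p′ : Fin m
  p′ = quotient (9 ^ k * 3) (combine p (combine u (fromSymbol e)))

  j : Fin (9 ^ k * 3)
  j = remainder {m} (9 ^ k * 3) (combine p (combine u (fromSymbol e)))

  acts≡ : tabulate (toAct ∘ finToFun {9} {k} u) ≡ w
  acts≡ = trans
    (tabulate-cong λ i → trans (cong toAct (finToFun-funToFin (fromAct ∘ lookup w) i)) (toAct-fromAct (lookup w i)))
    (tabulate∘lookup w)

toℕ-fromValue : (α : Maybe (Action m k)) → toℕ (fromValue α) ≡ actionCode α
toℕ-fromValue nothing = refl
toℕ-fromValue {m} {k} (just (action p w e)) = cong suc (begin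
  toℕ (combine p (combine u (fromSymbol e)))        ≡⟨ toℕ-combine′ p (combine u (fromSymbol e)) ⟩
  toℕ p * (9 ^ k * 3) + toℕ (combine u (fromSymbol e)) ≡⟨ cong (toℕ p * (9 ^ k * 3) +_) (toℕ-combine′ u (fromSymbol e)) ⟩
  toℕ p * (9 ^ k * 3) + (toℕ u * 3 + e#)            ≡⟨ +-assoc (toℕ p * (9 ^ k * 3)) (toℕ u * 3) e# ⟨
  toℕ p * (9 ^ k * 3) + toℕ u * 3 + e#              ≡⟨ cong (λ z → z + toℕ u * 3 + e#) (*-assoc (toℕ p) (9 ^ k) 3) ⟨
  toℕ p * 9 ^ k * 3 + toℕ u * 3 + e#                ≡⟨ cong (_+ e#) (*-distribʳ-+ 3 (toℕ p * 9 ^ k) (toℕ u)) ⟨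
  (toℕ p * 9 ^ k + toℕ u) * 3 + e#                  ∎)
  where
  open ≡-Reasoning
  u = funToFin (fromAct ∘ lookup w)
  e# = toℕ (fromSymbol e)

fromSymbol-toSymbol : ∀ i → fromSymbol (toSymbol i) ≡ i
fromSymbol-toSymbol zero             = refl
fromSymbol-toSymbol (suc zero)       = refl
fromSymbol-toSymbol (suc (suc zero)) = refl

fromMove-toMove : ∀ i → fromMove (toMove i) ≡ i
fromMove-toMove zero             = refl
fromMove-toMove (suc zero)       = refl
fromMove-toMove (suc (suc zero)) = refl

fromAct-toAct : ∀ i → fromAct (toAct i) ≡ i
fromAct-toAct i = trans
  (cong₂ combine (fromSymbol-toSymbol (quotient {3} 3 i)) (fromMove-toMove (remainder {3} 3 i)))
  (combine-remQuot {3} 3 i)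

fromValue-toValue : (x : Fin (#values m k)) → fromValue {m} {k} (toValue x) ≡ x
fromValue-toValue         zero    = refl
fromValue-toValue {m} {k} (suc i) = cong suc (trans
  (cong (combine (quotient {m} (9 ^ k * 3) i)) (trans
    (cong₂ combine
      (trans (funToFin-cong λ l → trans (cong fromAct (lookup∘tabulate (toAct ∘ finToFun {9} {k} w) l)) (fromAct-toAct _))
             (funToFin-finToFin {k} {9} w))
      (fromSymbol-toSymbol (remainder {9 ^ k} 3 j)))
    (combine-remQuot {9 ^ k} 3 j)))
  (combine-remQuot {m} (9 ^ k * 3) i))
  where
  j : Fin (9 ^ k * 3)
  j = remainder {m} (9 ^ k * 3) i
  w : Fin (9 ^ k)
  w = quotient {9 ^ k} 3 j

toℕ-fromArgument : (s : Fin m) (v : Vec Symbol k) →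
  toℕ (fromArgument s v) ≡ toℕ s * 3 ^ k + symbols (lookup v)
toℕ-fromArgument s v = toℕ-combine′ s (funToFin (fromSymbol ∘ lookup v))

valueAt : (m k t s v : ℕ) → ℕ
valueAt m k t s v = digit (#values m k) (#arguments m k) (s * 3 ^ k + v)
  (t mod′ #values m k ^ #arguments m k)

-- The reading direction. Since `fromValue` inverts `toValue` on both sides, a digit of the table is
-- determined by the transition that it decodes to.
valueAt-toδ : ∀ t (s : Fin m) (v : Vec Symbol k) →
  valueAt m k t (toℕ s) (symbols (lookup v)) ≡ actionCode (toδ t s v)
valueAt-toδ {m} {k} t s v = begin
  digit V N (toℕ s * 3 ^ k + symbols (lookup v)) (t mod′ V ^ N)
    ≡⟨ cong₂ (digit V N) (toℕ-fromArgument s v) (toℕ-mod t (V ^ N)) ⟨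
  digit V N (toℕ (fromArgument s v)) (toℕ (t mod (V ^ N)))
    ≡⟨ toℕ-finToFun {V} {N} (t mod (V ^ N)) (fromArgument s v) ⟨
  toℕ x
    ≡⟨ cong toℕ (fromValue-toValue {m} {k} x) ⟨
  toℕ (fromValue {m} {k} (toValue x))
    ≡⟨ toℕ-fromValue (toValue {m} {k} x) ⟩
  actionCode (toδ t s v) ∎
  where
  open ≡-Reasoning
  V N : ℕ
  V = #values m k
  N = #arguments m k
  instance
    V^N≢0 : NonZero (V ^ N)
    V^N≢0 = m^n≢0 V N
  x : Fin V
  x = finToFun {V} {N} (t mod (V ^ N)) (fromArgument s v)

table : (m k : ℕ) (F : ℕ → ℕ → ℕ) → ℕ
table m k F = horner (#values m k) (λ i → F (i ÷ 3 ^ k) (i mod′ 3 ^ k)) (#arguments m k)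

mod-toℕ : ∀ {n} .{{_ : NonZero n}} (i : Fin n) → toℕ i mod n ≡ i
mod-toℕ i = toℕ-injective (trans (toℕ-fromℕ< _) (m<n⇒m%n≡m (toℕ<n i)))

toδ-funToFin : (f : Fin (#arguments m k) → Fin (#values m k)) → ∀ s v →
  toδ {m} {k} (number f) s v ≡ toValue (f (fromArgument s v))
toδ-funToFin {m} {k} f s v = cong toValue (trans
  (cong (λ x → finToFun x (fromArgument s v)) (mod-toℕ (funToFin f)))
  (finToFun-funToFin f (fromArgument s v)))
  where
  instance
    V^N≢0 : NonZero (#values m k ^ #arguments m k)
    V^N≢0 = m^n≢0 (#values m k) (#arguments m k)

-- The writing direction. The index of an argument is `s * 3 ^ k + v` with `v < 3 ^ k`, so division
-- recovers both parts, and reduction modulo the base does not change the digit because an action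
-- code is below it.
toδ-table : ∀ (F : ℕ → ℕ → ℕ) (s : Fin m) (v : Vec Symbol k) α →
  F (toℕ s) (symbols (lookup v)) ≡ actionCode α → toδ (table m k F) s v ≡ α
toδ-table {m} {k} F s v α eq = begin
  toδ (table m k F) s v
    ≡⟨ cong (λ t → toδ {m} {k} t s v) (number-horner V N G) ⟨
  toδ {m} {k} (number {N} (λ i → G (toℕ i) mod V)) s v
    ≡⟨ toδ-funToFin {m} {k} (λ i → G (toℕ i) mod V) s v ⟩
  toValue (G (toℕ (fromArgument s v)) mod V)
    ≡⟨ cong (λ z → toValue (z mod V)) G-argument ⟩
  toValue (toℕ (fromValue α) mod V)
    ≡⟨ cong toValue (mod-toℕ (fromValue α)) ⟩
  toValue (fromValue α)
    ≡⟨ toValue-fromValue α ⟩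
  α ∎
  where
  open ≡-Reasoning
  V N : ℕ
  V = #values m k
  N = #arguments m k
  G : ℕ → ℕ
  G i = F (i ÷ 3 ^ k) (i mod′ 3 ^ k)

  v< : symbols (lookup v) < 3 ^ k
  v< = number< (fromSymbol ∘ lookup v)

  G-argument : G (toℕ (fromArgument s v)) ≡ toℕ (fromValue α)
  G-argument = begin
    G (toℕ (fromArgument s v))                    ≡⟨ cong G (toℕ-fromArgument s v) ⟩
    G (toℕ s * 3 ^ k + symbols (lookup v))        ≡⟨ cong₂ F (a*n+b÷n≡a (toℕ s) v<) (a*n+b-mod′-n≡b (toℕ s) v<) ⟩
    F (toℕ s) (symbols (lookup v))                ≡⟨ eq ⟩
    actionCode α                                  ≡⟨ toℕ-fromValue α ⟨
    toℕ (fromValue α)                             ∎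

transducerCode : (q k t : ℕ) → ℕ
transducerCode q k t = pair (pair q k) t

toTransducer-transducerCode : ∀ q k t → toTransducer (transducerCode q k t) ≡ transducer q k (toδ t)
toTransducer-transducerCode q k t rewrite unpair-pair (pair q k) t | unpair-pair q k = refl

toTransducer-surjective : ∀ q k δ → ∃[ c ] Σ[ t ∈ ℕ ]
  toTransducer c ≡ transducer q k (toδ t) × (∀ s v → toδ t s v ≡ δ s v)
toTransducer-surjective q k δ = transducerCode q k (number f) , number f ,
  toTransducer-transducerCode q k (number f) , λ s v → begin
    toδ (number f) s v
      ≡⟨ toδ-funToFin f s v ⟩
    toValue (f (fromArgument s v))
      ≡⟨ toValue-fromValue _ ⟩
    uncurry δ (decode (fromArgument s v))
      ≡⟨ cong (uncurry δ) (decode-fromArgument s v) ⟩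
    δ s v ∎
  where
  open ≡-Reasoning
  decode : Fin (#arguments (suc q) (suc k)) → Fin (suc q) × Vec Symbol (suc k)
  decode i = quotient (3 ^ suc k) i , tabulate (toSymbol ∘ finToFun {3} (remainder {suc q} (3 ^ suc k) i))

  decode-fromArgument : ∀ s v → decode (fromArgument s v) ≡ (s , v)
  decode-fromArgument s v = trans
    (cong (λ (q , j) → q , tabulate (toSymbol ∘ finToFun {3} j)) (remQuot-combine s (funToFin (fromSymbol ∘ lookup v))))
    (cong (s ,_) (trans
      (tabulate-cong λ i → trans (cong toSymbol (finToFun-funToFin (fromSymbol ∘ lookup v) i)) (toSymbol-fromSymbol (lookup v i)))
      (tabulate∘lookup v)))

  f : Fin (#arguments (suc q) (suc k)) → Fin (#values (suc q) (suc k))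
  f i = fromValue (uncurry δ (decode i))

-- Polynomials

infixl 6 _+ᴾ_
infixl 7 _*ᴾ_

_+ᴾ_ : Polynomial → Polynomial → Polynomial
[]      +ᴾ q       = q
(a ∷ p) +ᴾ []      = a ∷ p
(a ∷ p) +ᴾ (b ∷ q) = a + b ∷ p +ᴾ q

⟦+ᴾ⟧ : ∀ p q n → ⟦ p +ᴾ q ⟧ n ≡ ⟦ p ⟧ n + ⟦ q ⟧ n
⟦+ᴾ⟧ []      q       n = refl
⟦+ᴾ⟧ (a ∷ p) []      n = sym (+-identityʳ _)
⟦+ᴾ⟧ (a ∷ p) (b ∷ q) n rewrite ⟦+ᴾ⟧ p q n = arith a b n (⟦ p ⟧ n) (⟦ q ⟧ n)
  where
  arith : ∀ a b n x y → a + b + n * (x + y) ≡ a + n * x + (b + n * y)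
  arith = solve-∀

scaleᴾ : ℕ → Polynomial → Polynomial
scaleᴾ c = List.map (c *_)

⟦scaleᴾ⟧ : ∀ c p n → ⟦ scaleᴾ c p ⟧ n ≡ c * ⟦ p ⟧ n
⟦scaleᴾ⟧ c []      n = sym (*-zeroʳ c)
⟦scaleᴾ⟧ c (a ∷ p) n rewrite ⟦scaleᴾ⟧ c p n = arith c a n (⟦ p ⟧ n)
  where
  arith : ∀ c a n x → c * a + n * (c * x) ≡ c * (a + n * x)
  arith = solve-∀

_*ᴾ_ : Polynomial → Polynomial → Polynomial
[]      *ᴾ q = []
(a ∷ p) *ᴾ q = scaleᴾ a q +ᴾ (0 ∷ p *ᴾ q)

⟦*ᴾ⟧ : ∀ p q n → ⟦ p *ᴾ q ⟧ n ≡ ⟦ p ⟧ n * ⟦ q ⟧ n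
⟦*ᴾ⟧ []      q n = refl
⟦*ᴾ⟧ (a ∷ p) q n
  rewrite ⟦+ᴾ⟧ (scaleᴾ a q) (0 ∷ p *ᴾ q) n | ⟦scaleᴾ⟧ a q n | ⟦*ᴾ⟧ p q n
  = arith a n (⟦ p ⟧ n) (⟦ q ⟧ n)
  where
  arith : ∀ a n x y → a * y + n * (x * y) ≡ (a + n * x) * y
  arith = solve-∀

_∘ᴾ_ : Polynomial → Polynomial → Polynomial
[]      ∘ᴾ q = []
(a ∷ p) ∘ᴾ q = (a ∷ []) +ᴾ q *ᴾ (p ∘ᴾ q)

⟦∘ᴾ⟧ : ∀ p q n → ⟦ p ∘ᴾ q ⟧ n ≡ ⟦ p ⟧ (⟦ q ⟧ n)
⟦∘ᴾ⟧ []      q n = refl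
⟦∘ᴾ⟧ (a ∷ p) q n
  rewrite ⟦+ᴾ⟧ (a ∷ []) (q *ᴾ (p ∘ᴾ q)) n | ⟦*ᴾ⟧ q (p ∘ᴾ q) n | ⟦∘ᴾ⟧ p q n | *-zeroʳ n | +-identityʳ a
  = refl

constᴾ : ℕ → Polynomial
constᴾ c = c ∷ []

⟦constᴾ⟧ : ∀ c n → ⟦ constᴾ c ⟧ n ≡ c
⟦constᴾ⟧ c n = trans (cong (c +_) (*-zeroʳ n)) (+-identityʳ c)

idᴾ : Polynomial
idᴾ = 0 ∷ 1 ∷ []

⟦idᴾ⟧ : ∀ n → ⟦ idᴾ ⟧ n ≡ n
⟦idᴾ⟧ = arith
  where
  arith : ∀ n → n * (1 + n * 0) ≡ n
  arith = solve-∀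

⟦⟧-mono-≤ : ∀ p {m n} → m ≤ n → ⟦ p ⟧ m ≤ ⟦ p ⟧ n
⟦⟧-mono-≤ []      m≤n = z≤n
⟦⟧-mono-≤ (a ∷ p) m≤n = +-monoʳ-≤ a (*-mono-≤ m≤n (⟦⟧-mono-≤ p m≤n))

-- Tapes up to trailing blanks

cell : List Symbol → ℕ → Symbol
cell []       i       = nothing
cell (s ∷ ss) zero    = s
cell (s ∷ ss) (suc i) = cell ss i

infix 4 _≋_ _≈_

_≋_ : List Symbol → List Symbol → Set
ss ≋ ss′ = ∀ i → cell ss i ≡ cell ss′ i

record _≈_ (t u : Tape) : Set where
  constructor same
  field
    before≋ : before t ≋ before u
    scan≡   : scan t ≡ scan u
    after≋  : after t ≋ after u
open _≈_

≈-refl : ∀ {t} → t ≈ t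
≈-refl = same (λ _ → refl) refl (λ _ → refl)

≈-reflexive : ∀ {t u} → t ≡ u → t ≈ u
≈-reflexive refl = ≈-refl

≈-sym : ∀ {t u} → t ≈ u → u ≈ t
≈-sym (same b s a) = same (sym ∘ b) (sym s) (sym ∘ a)

≈-trans : ∀ {t u v} → t ≈ u → u ≈ v → t ≈ v
≈-trans (same b s a) (same b′ s′ a′) =
  same (λ i → trans (b i) (b′ i)) (trans s s′) (λ i → trans (a i) (a′ i))

∷-cong : ∀ {s s′ ss ss′} → s ≡ s′ → ss ≋ ss′ → s ∷ ss ≋ s′ ∷ ss′
∷-cong s≡ ss≋ zero    = s≡
∷-cong s≡ ss≋ (suc i) = ss≋ i

blank∷ : ∀ {ss} → ss ≋ [] → nothing ∷ ss ≋ []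
blank∷ ss≋ zero    = refl
blank∷ ss≋ (suc i) = ss≋ i

rest : List Symbol → List Symbol
rest []       = []
rest (_ ∷ ss) = ss

cell-rest : ∀ ss i → cell (rest ss) i ≡ cell ss (suc i)
cell-rest []       i = refl
cell-rest (_ ∷ ss) i = refl

rest-cong : ∀ ss ss′ → ss ≋ ss′ → rest ss ≋ rest ss′
rest-cong ss ss′ eq i = trans (cell-rest ss i) (trans (eq (suc i)) (sym (cell-rest ss′ i)))

shift-left : ∀ t → shift left t ≡ tape (rest (before t)) (cell (before t) 0) (scan t ∷ after t)
shift-left (tape []       s rs) = refl
shift-left (tape (l ∷ ls) s rs) = refl

shift-right : ∀ t → shift right t ≡ tape (scan t ∷ before t) (cell (after t) 0) (rest (after t))
shift-right (tape ls s [])       = refl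
shift-right (tape ls s (r ∷ rs)) = refl

shift-cong : ∀ d {t u} → t ≈ u → shift d t ≈ shift d u
shift-cong left  {t} {u} (same b s a) rewrite shift-left t | shift-left u =
  same (rest-cong (before t) (before u) b) (b 0) (∷-cong s a)
shift-cong stay  eq = eq
shift-cong right {t} {u} (same b s a) rewrite shift-right t | shift-right u =
  same (∷-cong s b) (a 0) (rest-cong (after t) (after u) a)

writeMove-cong : ∀ a {t u} → t ≈ u → writeMove a t ≈ writeMove a u
writeMove-cong (s , d) (same b _ a) = shift-cong d (same b refl a)

-- `idle` keeps blank tapes blank, and its code as an act is 0, so that idle
-- tapes contribute nothing to the code of an action.
idle erase : Symbol × Move
idle  = nothing , left
erase = nothing , right

idle-blank : ∀ {t} → t ≈ emptyTape → writeMove idle t ≈ emptyTape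
idle-blank eq = ≈-trans (writeMove-cong idle eq) (same (λ _ → refl) refl (blank∷ λ _ → refl))

-- The head is on the first letter of the word, with ss to the left of it.
at : List Symbol → Word → Tape
at ss []      = tape ss nothing []
at ss (b ∷ w) = tape ss (just b) (List.map just w)

inputTape≡at : ∀ w → inputTape w ≡ at [] w
inputTape≡at []      = refl
inputTape≡at (b ∷ w) = refl

shift-right-at : ∀ ss s w → shift right (tape ss s (List.map just w)) ≡ at (s ∷ ss) w
shift-right-at ss s []      = refl
shift-right-at ss s (b ∷ w) = refl

at-cong : ∀ {ss ss′} w → ss ≋ ss′ → at ss w ≈ at ss′ w
at-cong []      eq = same eq refl (λ _ → refl)
at-cong (b ∷ w) eq = same eq refl (λ _ → refl)

scan-at : ∀ {t ss} w → t ≈ at ss w → scan t ≡ List.head w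
scan-at []      eq = scan≡ eq
scan-at (b ∷ w) eq = scan≡ eq

-- Erasing a letter while passing over it makes the remaining word look like a fresh input: what
-- lies to the left is blank. A component can thus be started in the middle of the input.
erase-letter : ∀ {t b w} → t ≈ at [] (b ∷ w) → writeMove erase t ≈ at [] w
erase-letter {w = w} eq = ≈-trans (writeMove-cong erase eq)
  (≈-trans (≈-reflexive (shift-right-at [] nothing w)) (at-cong w (blank∷ λ _ → refl)))

keep : ∀ {t ss w} → t ≈ at ss w → writeMove (scan t , stay) t ≈ at ss w
keep {tape _ _ _} eq = eq

append-letter : ∀ {t} b l → t ≈ at (List.map just l) [] →
  writeMove (just b , right) t ≈ at (List.map just (b ∷ l)) []
append-letter b l eq = writeMove-cong (just b , right) eq

append-nothing : ∀ {t ss} → t ≈ at ss [] → writeMove (nothing , stay) t ≈ at ss []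
append-nothing eq = writeMove-cong (nothing , stay) eq

-- The head is on the letter before w, or on the blank before w if l is empty.
Rewinding : Word → Word → Tape → Set
Rewinding l w t = t ≈ shift left (at (List.map just l) w)

-- The head is on the blank behind the word, so rewriting that blank and moving left is already the
-- first step back.
rewind-start : ∀ {t} l → t ≈ at (List.map just l) [] → Rewinding l [] (writeMove idle t)
rewind-start l eq = writeMove-cong idle eq

scan-rewinding : ∀ l w {t} → Rewinding l w t → scan t ≡ List.head l
scan-rewinding []      []      eq = scan≡ eq
scan-rewinding []      (c ∷ w) eq = scan≡ eq
scan-rewinding (b ∷ l) []      eq = scan≡ eq
scan-rewinding (b ∷ l) (c ∷ w) eq = scan≡ eq

rewind-letter : ∀ {t} b l w → Rewinding (b ∷ l) w t → Rewinding l (b ∷ w) (writeMove (just b , left) t)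
rewind-letter b l w eq = shift-cong left (same (before≋ eq′) refl (after≋ eq′))
  where
  head-on : ∀ w → shift left (at (List.map just (b ∷ l)) w) ≈ at (List.map just l) (b ∷ w)
  head-on []      = same (λ _ → refl) refl (blank∷ λ _ → refl)
  head-on (c ∷ w) = ≈-refl

  eq′ = ≈-trans eq (head-on w)

rewind-end : ∀ {t} w → Rewinding [] w t → writeMove erase t ≈ at [] w
rewind-end []      eq = ≈-trans (writeMove-cong erase eq)
  (same (blank∷ λ _ → refl) refl (λ _ → refl))
rewind-end (b ∷ w) eq = ≈-trans (writeMove-cong erase eq)
  (same (blank∷ λ _ → refl) refl (λ _ → refl))

-- Machines

Response : Set → Set → Set
Response S W = S × (Maybe W → Symbol × Move) × Maybe Bool

-- Tape `nothing` holds the input; Work indexes the other tapes.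
record Machine : Set₁ where
  field
    State Work : Set
    start      : State
    δ          : State → (Maybe Work → Symbol) → Maybe (Response State Work)
    -- Tape contents are functions and are compared pointwise, so the transition has to respect
    -- pointwise equality.
    δ-cong     : ∀ s {v v′} → v ≗ v′ → δ s v ≡ δ s v′
open Machine

Tapes : Machine → Set
Tapes M = Maybe (Work M) → Tape

-- Halts M s T n y: from state s and tapes T, M halts within n steps and
-- emits y on its way.
data Halts (M : Machine) (s : State M) (T : Tapes M) : ℕ → Word → Set where
  stop : ∀ {n} → δ M s (scan ∘ T) ≡ nothing → Halts M s T n []
  go   : ∀ {s′ w e n y} → δ M s (scan ∘ T) ≡ just (s′ , w , e) →
         Halts M s′ (λ i → writeMove (w i) (T i)) n y →
         Halts M s T (suc n) (fromMaybe e ++ y)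

record Starting (M : Machine) (x : Word) (T : Tapes M) : Set where
  constructor starting
  field
    input : T nothing ≈ at [] x
    blank : ∀ j → T (just j) ≈ emptyTape

Computes : Machine → Polynomial → (Word → Word) → Set
Computes M p f = ∀ x T → Starting M x T → Halts M (start M) T (⟦ p ⟧ (length x)) (f x)

module _ {M : Machine} where

  Halts-≈ : ∀ {s T T′ n y} → (∀ i → T i ≈ T′ i) → Halts M s T n y → Halts M s T′ n y
  Halts-≈ {s} eq (stop e) = stop (trans (δ-cong M s (sym ∘ scan≡ ∘ eq)) e)
  Halts-≈ {s} eq (go {w = w} e h) =
    go (trans (δ-cong M s (sym ∘ scan≡ ∘ eq)) e) (Halts-≈ (λ i → writeMove-cong (w i) (eq i)) h)

  Halts-≤ : ∀ {s T m n y} → m ≤ n → Halts M s T m y → Halts M s T n y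
  Halts-≤ m≤n       (stop e) = stop e
  Halts-≤ (s≤s m≤n) (go e h) = go e (Halts-≤ m≤n h)

  -- A step emits at most one bit. This bounds the intermediate word of a composition, and later the
  -- length of `h x`.
  output-length : ∀ {s T n y} → Halts M s T n y → length y ≤ n
  output-length (stop _) = z≤n
  output-length (go {e = nothing} _ h) = m≤n⇒m≤1+n (output-length h)
  output-length (go {e = just _}  _ h) = s≤s (output-length h)

module _ {M M′ : Machine} (inj : State M′ → State M) (ι : Maybe (Work M′) → Maybe (Work M))
  (extend : (Maybe (Work M′) → Symbol × Move) → Maybe (Work M) → Symbol × Move)
  (extend-ι : ∀ w i → extend w (ι i) ≡ w i)
  (δ-inj : ∀ s v → δ M (inj s) v ≡ Maybe.map (λ (s′ , w , e) → inj s′ , extend w , e) (δ M′ s (v ∘ ι)))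
  where

  -- A component runs in lockstep inside a larger machine: the transition on its states sees only
  -- the tapes in the image of `ι` and acts on them as the component would. The remaining tapes may
  -- hold anything.
  embed : ∀ {s T T′ n y} → (∀ i → T (ι i) ≈ T′ i) → Halts M′ s T′ n y → Halts M (inj s) T n y
  embed {s} {T} eq (stop e) =
    stop (trans (δ-inj s (scan ∘ T)) (cong (Maybe.map _) (trans (δ-cong M′ s (scan≡ ∘ eq)) e)))
  embed {s} {T} eq (go {w = w} e h) =
    go (trans (δ-inj s (scan ∘ T)) (cong (Maybe.map _) (trans (δ-cong M′ s (scan≡ ∘ eq)) e)))
      (embed (λ i → subst (λ a → writeMove a (T (ι i)) ≈ _) (sym (extend-ι w i)) (writeMove-cong (w i) (eq i))) h)

only : {W : Set} → Symbol × Move → Maybe W → Symbol × Move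
only a nothing  = a
only a (just _) = idle

-- Composition

data SequenceState (S₁ S₂ : Set) : Set where
  run₁   : S₁ → SequenceState S₁ S₂
  rewind : SequenceState S₁ S₂
  run₂   : S₂ → SequenceState S₁ S₂

module Sequence (M₁ M₂ : Machine) where

  S : Set
  S = SequenceState (State M₁) (State M₂)

  W : Set
  W = Work M₁ ⊎ Maybe (Work M₂)

  ι₁ : Maybe (Work M₁) → Maybe W
  ι₁ = Maybe.map inj₁

  -- The input tape of `M₂` becomes a work tape, on which the output of `M₁` is recorded.
  ι₂ : Maybe (Work M₂) → Maybe W
  ι₂ i = just (inj₂ i)

  both : (Maybe (Work M₁) → Symbol × Move) → (Maybe (Work M₂) → Symbol × Move) → Maybe W → Symbol × Move
  both w₁ w₂ nothing         = w₁ nothing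
  both w₁ w₂ (just (inj₁ j)) = w₁ (just j)
  both w₁ w₂ (just (inj₂ i)) = w₂ i

  both-ι₁ : ∀ w₁ w₂ i → both w₁ w₂ (ι₁ i) ≡ w₁ i
  both-ι₁ w₁ w₂ nothing  = refl
  both-ι₁ w₁ w₂ (just j) = refl

  idles : ∀ {V : Set} → Maybe V → Symbol × Move
  idles _ = idle

  record-emission : Maybe Bool → Symbol × Move
  record-emission nothing  = nothing , stay
  record-emission (just b) = just b , right

  response₁ : Maybe (Response (State M₁) (Work M₁)) → Maybe (Response S W)
  response₁ nothing             = just (rewind , both idles idles , nothing)
  response₁ (just (s , w , e)) = just (run₁ s , both w (only (record-emission e)) , nothing)

  responseᵣ : Symbol → Maybe (Response S W)
  responseᵣ nothing  = just (run₂ (start M₂) , both idles (only erase) , nothing)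
  responseᵣ (just b) = just (rewind , both idles (only (just b , left)) , nothing)

  response₂ : Maybe (Response (State M₂) (Work M₂)) → Maybe (Response S W)
  response₂ = Maybe.map (λ (s , w , e) → run₂ s , both idles w , e)

  δˢ : S → (Maybe W → Symbol) → Maybe (Response S W)
  δˢ (run₁ s) v = response₁ (δ M₁ s (v ∘ ι₁))
  δˢ rewind   v = responseᵣ (v (ι₂ nothing))
  δˢ (run₂ s) v = response₂ (δ M₂ s (v ∘ ι₂))

  δˢ-cong : ∀ s {v v′} → v ≗ v′ → δˢ s v ≡ δˢ s v′
  δˢ-cong (run₁ s) eq = cong response₁ (δ-cong M₁ s (eq ∘ ι₁))
  δˢ-cong rewind   eq = cong responseᵣ (eq (ι₂ nothing))
  δˢ-cong (run₂ s) eq = cong response₂ (δ-cong M₂ s (eq ∘ ι₂))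

  sequence : Machine
  sequence = record { State = S ; Work = W ; start = run₁ (start M₁) ; δ = δˢ ; δ-cong = δˢ-cong }

  Blank₂ : Tapes sequence → Set
  Blank₂ T = ∀ j → T (ι₂ (just j)) ≈ emptyTape

  rewind-halts : ∀ {n y} l w T → Rewinding l w (T (ι₂ nothing)) → Blank₂ T →
    (∀ T → Starting M₂ (l ʳ++ w) (T ∘ ι₂) → Halts sequence (run₂ (start M₂)) T n y) →
    Halts sequence rewind T (suc (length l) + n) y
  rewind-halts [] w T at-l blank K =
    go (cong responseᵣ (scan-rewinding [] w at-l))
      (K _ (starting (rewind-end w at-l) (idle-blank ∘ blank)))
  rewind-halts (b ∷ l) w T at-l blank K =
    go (cong responseᵣ (scan-rewinding (b ∷ l) w at-l))
      (rewind-halts l (b ∷ w) _ (rewind-letter b l w at-l) (idle-blank ∘ blank) K)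

  -- `l` is the output recorded so far, reversed because it lies to the left of the head. The last
  -- hypothesis is a continuation describing the run from `rewind` on; the extra step is the switch
  -- to that state.
  run₁-halts : ∀ {s T₁ n y m z} → Halts M₁ s T₁ n y → ∀ l T → (∀ i → T (ι₁ i) ≈ T₁ i) →
    T (ι₂ nothing) ≈ at (List.map just l) [] → Blank₂ T →
    (∀ T → Rewinding (y ʳ++ l) [] (T (ι₂ nothing)) → Blank₂ T → Halts sequence rewind T m z) →
    Halts sequence (run₁ s) T (n + suc m) z
  run₁-halts {s} {n = n} (stop e) l T eq at-l blank K =
    Halts-≤ (m≤n+m _ n) (go (cong response₁ (trans (δ-cong M₁ s (_≈_.scan≡ ∘ eq)) e))
      (K _ (rewind-start l at-l) (idle-blank ∘ blank)))
  run₁-halts {s} (go {w = w} {e = e₁} e h) l T eq at-l blank K =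
    go (cong response₁ (trans (δ-cong M₁ s (_≈_.scan≡ ∘ eq)) e)) (next-step e₁ K)
    where
    eq′ : ∀ {a} i → writeMove (both w a (ι₁ i)) (T (ι₁ i)) ≈ _
    eq′ {a} i = subst (λ c → writeMove c (T (ι₁ i)) ≈ _) (sym (both-ι₁ w a i)) (writeMove-cong (w i) (eq i))

    next-step : ∀ e {m z} →
      (∀ T → Rewinding ((fromMaybe e ++ _) ʳ++ l) [] (T (ι₂ nothing)) → Blank₂ T → Halts sequence rewind T m z) →
      Halts sequence (run₁ _) (λ i → writeMove (both w (only (record-emission e)) i) (T i)) (_ + suc m) z
    next-step nothing  K = run₁-halts h l _ eq′ (append-nothing at-l) (idle-blank ∘ blank) K
    next-step (just b) K = run₁-halts h (b ∷ l) _ eq′ (append-letter b l at-l) (idle-blank ∘ blank) K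

  run₂-halts : ∀ {s T n y} → Halts M₂ s (T ∘ ι₂) n y → Halts sequence (run₂ s) T n y
  run₂-halts = embed run₂ ι₂ (both idles) (λ _ _ → refl) (λ _ _ → refl) (λ _ → ≈-refl)

  -- The summands pay for running `M₁`, for entering and leaving `rewind`, for walking back over the
  -- intermediate word, whose length is at most the running time of `M₁`, and for running `M₂` on
  -- it.
  sequenceᴾ : Polynomial → Polynomial → Polynomial
  sequenceᴾ p₁ p₂ = p₁ +ᴾ (constᴾ 2 +ᴾ (p₁ +ᴾ (p₂ ∘ᴾ p₁)))

  sequence-computes : ∀ {p₁ p₂ f₁ f₂} → Computes M₁ p₁ f₁ → Computes M₂ p₂ f₂ →
    Computes sequence (sequenceᴾ p₁ p₂) (f₂ ∘ f₁)
  sequence-computes {p₁} {p₂} {f₁} {f₂} C₁ C₂ x T (starting input blank) =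
    Halts-≤ bound (run₁-halts H₁ [] T (λ _ → ≈-refl) (blank (inj₂ nothing)) (λ j → blank (inj₂ (just j)))
      λ T at-l blank → rewind-halts (f₁ x ʳ++ []) [] T at-l blank
        λ T st → run₂-halts (subst₂ (λ m y → Halts M₂ (start M₂) (T ∘ ι₂) m y)
          (cong (⟦ p₂ ⟧ ∘ length) reversed) (cong f₂ reversed) (C₂ _ (T ∘ ι₂) st)))
    where
    open ≤-Reasoning hiding (start)
    N = length x

    reversed : (f₁ x ʳ++ []) ʳ++ [] ≡ f₁ x
    reversed = reverse-involutive (f₁ x)

    H₁ : Halts M₁ (start M₁) (T ∘ ι₁) (⟦ p₁ ⟧ N) (f₁ x)
    H₁ = C₁ x (T ∘ ι₁) (starting input λ j → blank (inj₁ j))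

    L≤ : length (f₁ x) ≤ ⟦ p₁ ⟧ N
    L≤ = output-length H₁

    bound : ⟦ p₁ ⟧ N + suc (suc (length (f₁ x ʳ++ [])) + ⟦ p₂ ⟧ (length (f₁ x))) ≤ ⟦ sequenceᴾ p₁ p₂ ⟧ N
    bound = begin
      ⟦ p₁ ⟧ N + (2 + (length (f₁ x ʳ++ []) + ⟦ p₂ ⟧ (length (f₁ x))))
        ≡⟨ cong (λ k → ⟦ p₁ ⟧ N + (2 + (k + ⟦ p₂ ⟧ (length (f₁ x))))) (trans (length-ʳ++ (f₁ x)) (+-identityʳ _)) ⟩
      ⟦ p₁ ⟧ N + (2 + (length (f₁ x) + ⟦ p₂ ⟧ (length (f₁ x))))
        ≤⟨ +-monoʳ-≤ (⟦ p₁ ⟧ N) (+-monoʳ-≤ 2 (+-mono-≤ L≤ (⟦⟧-mono-≤ p₂ L≤))) ⟩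
      ⟦ p₁ ⟧ N + (2 + (⟦ p₁ ⟧ N + ⟦ p₂ ⟧ (⟦ p₁ ⟧ N)))
        ≡⟨ cong (λ k → ⟦ p₁ ⟧ N + (2 + (⟦ p₁ ⟧ N + k))) (⟦∘ᴾ⟧ p₂ p₁ N) ⟨
      ⟦ p₁ ⟧ N + (2 + (⟦ p₁ ⟧ N + ⟦ p₂ ∘ᴾ p₁ ⟧ N))
        ≡⟨ cong (λ k → ⟦ p₁ ⟧ N + (2 + k)) (⟦+ᴾ⟧ p₁ (p₂ ∘ᴾ p₁) N) ⟨
      ⟦ p₁ ⟧ N + (2 + ⟦ p₁ +ᴾ (p₂ ∘ᴾ p₁) ⟧ N)
        ≡⟨ cong (⟦ p₁ ⟧ N +_) (trans (⟦+ᴾ⟧ (constᴾ 2) (p₁ +ᴾ (p₂ ∘ᴾ p₁)) N) (cong (_+ ⟦ p₁ +ᴾ (p₂ ∘ᴾ p₁) ⟧ N) (⟦constᴾ⟧ 2 N))) ⟨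
      ⟦ p₁ ⟧ N + ⟦ constᴾ 2 +ᴾ (p₁ +ᴾ (p₂ ∘ᴾ p₁)) ⟧ N
        ≡⟨ ⟦+ᴾ⟧ p₁ (constᴾ 2 +ᴾ (p₁ +ᴾ (p₂ ∘ᴾ p₁))) N ⟨
      ⟦ sequenceᴾ p₁ p₂ ⟧ N ∎

-- Dispatch on a prefix of the input

-- The pair of u and w is coded as 1u₁1u₂…1uₖ0w.
onSecond : (Word → Word) → Word → Word
onSecond f []             = []
onSecond f (false ∷ x)    = false ∷ f x
onSecond f (true ∷ [])    = true ∷ []
onSecond f (true ∷ b ∷ x) = true ∷ b ∷ onSecond f x

-- The empty word carries no tag; sending it to `f₁ []` keeps the range the union of the two ranges.
union : (Word → Word) → (Word → Word) → Word → Word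
union f₁ f₂ []          = f₁ []
union f₁ f₂ (false ∷ x) = f₁ x
union f₁ f₂ (true ∷ x)  = f₂ x

data DispatchState (S₁ S₂ : Set) : Set where
  seen seen1 : DispatchState S₁ S₂
  run₁       : S₁ → DispatchState S₁ S₂
  run₂       : S₂ → DispatchState S₁ S₂

-- The machine computes `onSecond f₁` or `union f₁ f₂`, depending on `paired`.
module Dispatch (paired : Bool) (M₁ M₂ : Machine) where

  S : Set
  S = DispatchState (State M₁) (State M₂)

  W : Set
  W = Work M₁ ⊎ Work M₂

  ι₁ : Maybe (Work M₁) → Maybe W
  ι₁ = Maybe.map inj₁

  ι₂ : Maybe (Work M₂) → Maybe W
  ι₂ = Maybe.map inj₂

  extend₁ : (Maybe (Work M₁) → Symbol × Move) → Maybe W → Symbol × Move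
  extend₁ w nothing         = w nothing
  extend₁ w (just (inj₁ j)) = w (just j)
  extend₁ w (just (inj₂ j)) = idle

  extend₂ : (Maybe (Work M₂) → Symbol × Move) → Maybe W → Symbol × Move
  extend₂ w nothing         = w nothing
  extend₂ w (just (inj₁ j)) = idle
  extend₂ w (just (inj₂ j)) = w (just j)

  extend₁-ι₁ : ∀ w i → extend₁ w (ι₁ i) ≡ w i
  extend₁-ι₁ w nothing  = refl
  extend₁-ι₁ w (just j) = refl

  extend₂-ι₂ : ∀ w i → extend₂ w (ι₂ i) ≡ w i
  extend₂-ι₂ w nothing  = refl
  extend₂-ι₂ w (just j) = refl

  consume : S → Maybe Bool → Maybe (Response S W)
  consume s e = just (s , only erase , e)

  -- In the paired case the first component is echoed to the output and erased, so that `M₁` finds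
  -- just the second component and its output continues the echoed prefix.
  onSeen : Bool → Symbol → Maybe (Response S W)
  onSeen true  nothing      = nothing
  onSeen true  (just false) = consume (run₁ (start M₁)) (just false)
  onSeen true  (just true)  = consume seen1 (just true)
  onSeen false nothing      = consume (run₁ (start M₁)) nothing
  onSeen false (just false) = consume (run₁ (start M₁)) nothing
  onSeen false (just true)  = consume (run₂ (start M₂)) nothing

  onSeen1 : Symbol → Maybe (Response S W)
  onSeen1 nothing  = nothing
  onSeen1 (just b) = consume seen (just b)

  response₁ : Maybe (Response (State M₁) (Work M₁)) → Maybe (Response S W)
  response₁ = Maybe.map (λ (s , w , e) → run₁ s , extend₁ w , e)

  response₂ : Maybe (Response (State M₂) (Work M₂)) → Maybe (Response S W)
  response₂ = Maybe.map (λ (s , w , e) → run₂ s , extend₂ w , e)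

  δᵈ : S → (Maybe W → Symbol) → Maybe (Response S W)
  δᵈ seen     v = onSeen paired (v nothing)
  δᵈ seen1    v = onSeen1 (v nothing)
  δᵈ (run₁ s) v = response₁ (δ M₁ s (v ∘ ι₁))
  δᵈ (run₂ s) v = response₂ (δ M₂ s (v ∘ ι₂))

  δᵈ-cong : ∀ s {v v′} → v ≗ v′ → δᵈ s v ≡ δᵈ s v′
  δᵈ-cong seen     eq = cong (onSeen paired) (eq nothing)
  δᵈ-cong seen1    eq = cong onSeen1 (eq nothing)
  δᵈ-cong (run₁ s) eq = cong response₁ (δ-cong M₁ s (eq ∘ ι₁))
  δᵈ-cong (run₂ s) eq = cong response₂ (δ-cong M₂ s (eq ∘ ι₂))

  dispatcher : Machine
  dispatcher = record { State = S ; Work = W ; start = seen ; δ = δᵈ ; δ-cong = δᵈ-cong }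

  run₁-halts : ∀ p {f} → Computes M₁ p f → ∀ x T → Starting dispatcher x T →
    Halts dispatcher (run₁ (start M₁)) T (⟦ p ⟧ (length x)) (f x)
  run₁-halts p C x T (starting input blank) =
    embed run₁ ι₁ extend₁ extend₁-ι₁ (λ _ _ → refl) (λ _ → ≈-refl) (C x (T ∘ ι₁) (starting input λ j → blank (inj₁ j)))

  run₂-halts : ∀ p {f} → Computes M₂ p f → ∀ x T → Starting dispatcher x T →
    Halts dispatcher (run₂ (start M₂)) T (⟦ p ⟧ (length x)) (f x)
  run₂-halts p C x T (starting input blank) =
    embed run₂ ι₂ extend₂ extend₂-ι₂ (λ _ _ → refl) (λ _ → ≈-refl) (C x (T ∘ ι₂) (starting input λ j → blank (inj₂ j)))

  advance : ∀ {b x T} → Starting dispatcher (b ∷ x) T →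
    Starting dispatcher x (λ i → writeMove (only erase i) (T i))
  advance (starting input blank) = starting (erase-letter input) (idle-blank ∘ blank)

  advance-[] : ∀ {T} → Starting dispatcher [] T →
    Starting dispatcher [] (λ i → writeMove (only erase i) (T i))
  advance-[] (starting input blank) = starting
    (≈-trans (writeMove-cong erase input) (at-cong [] (blank∷ λ _ → refl))) (idle-blank ∘ blank)

module _ (M₁ M₂ : Machine) where

  module _ where
    open Dispatch true M₁ M₂

    paired-computes : ∀ {p f} → Computes M₁ p f → Computes dispatcher (idᴾ +ᴾ p) (onSecond f)
    paired-computes {p} {f} C x T st = subst (λ n → Halts dispatcher seen T n (onSecond f x))
      (sym (trans (⟦+ᴾ⟧ idᴾ p (length x)) (cong (_+ ⟦ p ⟧ (length x)) (⟦idᴾ⟧ (length x)))))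
      (seen-halts x T ≤-refl st)
      where
      -- `n` stays the length of the whole input while `x` shrinks, so that the time of `M₁` is
      -- bounded by one and the same number throughout.
      seen-halts : ∀ {n} x T → length x ≤ n → Starting dispatcher x T →
        Halts dispatcher seen T (length x + ⟦ p ⟧ n) (onSecond f x)
      seen-halts [] T x≤n (starting input _) = stop (cong (onSeen true) (scan-at [] input))
      seen-halts (false ∷ x) T x≤n st@(starting input _) =
        go (cong (onSeen true) (scan-at (false ∷ x) input))
          (Halts-≤ (≤-trans (⟦⟧-mono-≤ p (<⇒≤ x≤n)) (m≤n+m _ (length x))) (run₁-halts p C x _ (advance st)))
      seen-halts (true ∷ []) T x≤n st@(starting input _) =
        go (cong (onSeen true) (scan-at (true ∷ []) input))
          (stop (cong onSeen1 (scan-at [] (Starting.input (advance st)))))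
      seen-halts (true ∷ b ∷ x) T x≤n st@(starting input _) =
        go (cong (onSeen true) (scan-at (true ∷ b ∷ x) input))
          (go (cong onSeen1 (scan-at (b ∷ x) (Starting.input (advance st))))
            (seen-halts x _ (≤-trans (n≤1+n _) (<⇒≤ x≤n)) (advance (advance st))))

  module _ where
    open Dispatch false M₁ M₂

    union-computes : ∀ {p₁ p₂ f₁ f₂} → Computes M₁ p₁ f₁ → Computes M₂ p₂ f₂ →
      Computes dispatcher (constᴾ 1 +ᴾ (p₁ +ᴾ p₂)) (union f₁ f₂)
    union-computes {p₁} {p₂} {f₁} {f₂} C₁ C₂ x T st = subst (λ n → Halts dispatcher seen T n (union f₁ f₂ x))
      (sym (trans (⟦+ᴾ⟧ (constᴾ 1) (p₁ +ᴾ p₂) (length x)) (cong₂ _+_ (⟦constᴾ⟧ 1 (length x)) (⟦+ᴾ⟧ p₁ p₂ (length x)))))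
      (seen-halts x st)
      where
      seen-halts : ∀ x → Starting dispatcher x T →
        Halts dispatcher seen T (suc (⟦ p₁ ⟧ (length x) + ⟦ p₂ ⟧ (length x))) (union f₁ f₂ x)
      seen-halts [] st@(starting input _) =
        go (cong (onSeen false) (scan-at [] input)) (Halts-≤ (m≤m+n _ _) (run₁-halts p₁ C₁ [] _ (advance-[] st)))
      seen-halts (false ∷ x) st@(starting input _) =
        go (cong (onSeen false) (scan-at (false ∷ x) input))
          (Halts-≤ (≤-trans (⟦⟧-mono-≤ p₁ (n≤1+n (length x))) (m≤m+n _ _)) (run₁-halts p₁ C₁ x _ (advance st)))
      seen-halts (true ∷ x) st@(starting input _) =
        go (cong (onSeen false) (scan-at (true ∷ x) input))
          (Halts-≤ (≤-trans (⟦⟧-mono-≤ p₂ (n≤1+n (length x))) (m≤n+m _ (⟦ p₁ ⟧ (suc (length x))))) (run₂-halts p₂ C₂ x _ (advance st)))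

-- Comparison

_≡ᵇʷ_ : Word → Word → Bool
[]      ≡ᵇʷ []      = true
[]      ≡ᵇʷ (_ ∷ _) = false
(_ ∷ _) ≡ᵇʷ []      = false
(b ∷ x) ≡ᵇʷ (c ∷ y) = if does (b ≟ᵇ c) then x ≡ᵇʷ y else false

≡ᵇʷ-sound : ∀ x y → x ≡ᵇʷ y ≡ true → x ≡ y
≡ᵇʷ-sound []      []      _ = refl
≡ᵇʷ-sound (b ∷ x) (c ∷ y) e with b ≟ᵇ c
... | yes refl = cong (b ∷_) (≡ᵇʷ-sound x y e)

≡ᵇʷ-refl : ∀ x → x ≡ᵇʷ x ≡ true
≡ᵇʷ-refl []      = refl
≡ᵇʷ-refl (false ∷ x) = ≡ᵇʷ-refl x
≡ᵇʷ-refl (true  ∷ x) = ≡ᵇʷ-refl x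

module CheckFunction (r : Word → Word) (default : Word) where

  -- The first argument is the reversal of the part of the claim read so far.
  check check₁ : Word → Word → Word
  check l []          = default
  check l (false ∷ y) = let u = l ʳ++ [] in if r u ≡ᵇʷ y then u else default
  check l (true ∷ y)  = check₁ l y
  check₁ l []         = default
  check₁ l (b ∷ y)    = check (b ∷ l) y

-- `parse` and `parse₁` copy the claim, `rewind` returns to its start, `run` compares, `emitting`
-- outputs the claim, and `failing i` spells the default from its letter `i` on.
data CheckState (S : Set) (n : ℕ) : Set where
  parse parse₁ rewind emitting : CheckState S n
  run     : S → CheckState S n
  failing : Fin (suc n) → CheckState S n

module Check (M : Machine) (default : Word) where

  S : Set
  S = CheckState (State M) (length default)

  -- Besides the tapes of `M` there is one that preserves the claim. The claim is written twice
  -- because `M` may overwrite its own input tape.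
  W : Set
  W = Maybe (Maybe (Work M))

  pattern input = nothing
  pattern claim = just nothing
  pattern ι i   = just (just i)

  acting : (a c : Symbol × Move) (w : Maybe (Work M) → Symbol × Move) → Maybe W → Symbol × Move
  acting a c w input = a
  acting a c w claim = c
  acting a c w (ι i) = w i

  idles : Maybe W → Symbol × Move
  idles _ = idle

  unchanged : Symbol → Symbol × Move
  unchanged s = s , stay

  letter : (w : Word) → Fin (suc (length w)) → Maybe (Bool × Fin (suc (length w)))
  letter []      zero    = nothing
  letter (b ∷ w) zero    = just (b , suc zero)
  letter (b ∷ w) (suc i) = Maybe.map (map₂ suc) (letter w i)

  -- Bits are emitted only by `emitting` and `failing`, so the output is still empty here and
  -- becomes exactly the default.
  fail : Maybe (Response S W)
  fail = just (failing zero , idles , nothing)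

  onParse onParse₁ onRewind onEmitting : (vᵢ v : Symbol) → Maybe (Response S W)
  onParse vᵢ nothing        = fail
  onParse vᵢ (just true)    = just (parse₁ , acting erase (unchanged nothing) (only (unchanged nothing)) , nothing)
  onParse vᵢ (just false)   = just (rewind , acting erase idle (λ _ → idle) , nothing)
  onParse₁ vᵢ nothing       = fail
  onParse₁ vᵢ (just b)      = just (parse , acting erase (just b , right) (only (just b , right)) , nothing)
  onRewind vᵢ nothing       = just (run (start M) , acting (unchanged vᵢ) erase (only erase) , nothing)
  onRewind vᵢ (just b)      = just (rewind , acting (unchanged vᵢ) (just b , left) (only (just b , left)) , nothing)
  onEmitting vᵢ nothing     = nothing
  onEmitting vᵢ (just b)    = just (emitting , acting idle erase (λ _ → idle) , just b)

  matching : Bool → Symbol → State M → (Maybe (Work M) → Symbol × Move) → Maybe (Response S W)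
  matching true  v s w = just (run s , acting erase (unchanged v) w , nothing)
  matching false v s w = fail

  matches : Bool → Symbol → Bool
  matches b nothing  = false
  matches b (just c) = does (b ≟ᵇ c)

  -- The output of `M` is never stored: each emitted bit is matched against the next input letter,
  -- which is erased. Acceptance requires that `M` halt when the input is used up.
  onRun : Maybe (Response (State M) (Work M)) → (vᵢ v : Symbol) → Maybe (Response S W)
  onRun nothing nothing  v = just (emitting , acting idle (unchanged v) (λ _ → idle) , nothing)
  onRun nothing (just _) v = fail
  onRun (just (s , w , nothing)) vᵢ v = just (run s , acting (unchanged vᵢ) (unchanged v) w , nothing)
  onRun (just (s , w , just b))  vᵢ v = matching (matches b vᵢ) v s w

  onFailing : ∀ {A : Set} → (A → S) → Maybe (Bool × A) → Maybe (Response S W)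
  onFailing f = Maybe.map (λ (b , i) → f i , idles , just b)

  δᶜ : S → (Maybe W → Symbol) → Maybe (Response S W)
  δᶜ parse       v = onParse (v input) (v input)
  δᶜ parse₁      v = onParse₁ (v input) (v input)
  δᶜ rewind      v = onRewind (v input) (v claim)
  δᶜ emitting    v = onEmitting (v input) (v claim)
  δᶜ (run s)     v = onRun (δ M s (λ i → v (ι i))) (v input) (v claim)
  δᶜ (failing i) v = onFailing failing (letter default i)

  δᶜ-cong : ∀ s {v v′} → v ≗ v′ → δᶜ s v ≡ δᶜ s v′
  δᶜ-cong parse       eq = cong₂ onParse (eq input) (eq input)
  δᶜ-cong parse₁      eq = cong₂ onParse₁ (eq input) (eq input)
  δᶜ-cong rewind      eq = cong₂ onRewind (eq input) (eq claim)
  δᶜ-cong emitting    eq = cong₂ onEmitting (eq input) (eq claim)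
  δᶜ-cong (failing i) eq = refl
  δᶜ-cong (run s) {v} {v′} eq rewrite eq input | eq claim = cong (λ a → onRun a (v′ input) (v′ claim)) (δ-cong M s (λ i → eq (ι i)))

  checker : Machine
  checker = record { State = S ; Work = W ; start = parse ; δ = δᶜ ; δ-cong = δᶜ-cong }

  failing-halts : ∀ T → Halts checker (failing zero) T (length default) default
  failing-halts T = spell default failing T (λ _ _ → refl)
    where
    onFailing-suc : ∀ {n} (f : Fin (suc n) → S) (x : Maybe (Bool × Fin n)) →
      onFailing f (Maybe.map (map₂ suc) x) ≡ onFailing (f ∘ suc) x
    onFailing-suc f nothing  = refl
    onFailing-suc f (just _) = refl

    -- The state map `f` is generalized so that the induction can pass to a suffix of the default
    -- while the type of states stays fixed.
    spell : ∀ w (f : Fin (suc (length w)) → S) T →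
      (∀ i v → δᶜ (f i) v ≡ onFailing f (letter w i)) → Halts checker (f zero) T (length w) w
    spell []      f T eq = stop (eq zero _)
    spell (b ∷ w) f T eq = go (eq zero _)
      (spell w (f ∘ suc) _ (λ i v → trans (eq (suc i) v) (onFailing-suc f (letter w i))))

  emitting-halts : ∀ u T → T claim ≈ at [] u → Halts checker emitting T (length u) u
  emitting-halts []      T at-u = stop (cong (onEmitting (scan (T input))) (scan-at [] at-u))
  emitting-halts (b ∷ u) T at-u = go (cong (onEmitting (scan (T input))) (scan-at (b ∷ u) at-u))
    (emitting-halts u _ (erase-letter at-u))

  verdict : Bool → Word → Word
  verdict c u = if c then u else default

  -- Matched letters are gone from both sides, so the verdict on the remaining output `y` and
  -- remaining input `v` is the verdict on the whole. `K` covers whichever word is output, and the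
  -- extra step is the switch to outputting it.
  run-halts : ∀ {s T₁ n y K} → Halts M s T₁ n y → ∀ T u v →
    (∀ i → T (ι i) ≈ T₁ i) → T input ≈ at [] v → T claim ≈ at [] u →
    length u ≤ K → length default ≤ K →
    Halts checker (run s) T (n + suc K) (verdict (y ≡ᵇʷ v) u)
  run-halts {s} {n = n} (stop e) T u [] eq at-v at-u u≤K d≤K =
    Halts-≤ (m≤n+m _ n) (go (cong₂ (λ a b → onRun b a (scan (T claim))) (scan-at [] at-v) (trans (δ-cong M s (_≈_.scan≡ ∘ eq)) e))
      (Halts-≤ u≤K (emitting-halts u _ (keep {w = u} at-u))))
  run-halts {s} {n = n} (stop e) T u (c ∷ v) eq at-v at-u u≤K d≤K =
    Halts-≤ (m≤n+m _ n) (go (cong₂ (λ a b → onRun b a (scan (T claim))) (scan-at (c ∷ v) at-v) (trans (δ-cong M s (_≈_.scan≡ ∘ eq)) e))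
      (Halts-≤ d≤K (failing-halts _)))
  run-halts {s} (go {w = w} {e = nothing} e h) T u v eq at-v at-u u≤K d≤K =
    go (cong (λ a → onRun a (scan (T input)) (scan (T claim))) (trans (δ-cong M s (_≈_.scan≡ ∘ eq)) e))
      (run-halts h _ u v (λ i → writeMove-cong (w i) (eq i)) (keep {w = v} at-v) (keep {w = u} at-u) u≤K d≤K)
  run-halts {s} (go {w = w} {e = just b} {n = n} e h) T u [] eq at-v at-u u≤K d≤K =
    go (cong₂ (λ a b → onRun b a (scan (T claim))) (scan-at [] at-v) (trans (δ-cong M s (_≈_.scan≡ ∘ eq)) e))
      (Halts-≤ (≤-trans d≤K (≤-trans (n≤1+n _) (m≤n+m _ n))) (failing-halts _))
  run-halts {s} {K = K} (go {s′ = s′} {w = w} {e = just b} {n = n} {y = y} e h) T u (c ∷ v) eq at-v at-u u≤K d≤K =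
    go-matching (does (b ≟ᵇ c))
      (cong₂ (λ a b → onRun b a (scan (T claim))) (scan-at (c ∷ v) at-v) (trans (δ-cong M s (_≈_.scan≡ ∘ eq)) e))
    where
    -- Abstracting the outcome of the letter comparison lets the transition and the word comparison
    -- reduce together.
    go-matching : ∀ d → δᶜ (run s) (scan ∘ T) ≡ matching d (scan (T claim)) s′ w →
      Halts checker (run s) T (suc n + suc K) (verdict (if d then y ≡ᵇʷ v else false) u)
    go-matching true  e = go e (run-halts h _ u v (λ i → writeMove-cong (w i) (eq i)) (erase-letter at-v) (keep {w = u} at-u) u≤K d≤K)
    go-matching false e = go e (Halts-≤ (≤-trans d≤K (≤-trans (n≤1+n _) (m≤n+m _ n))) (failing-halts _))

  BlankWork : Tapes checker → Set
  BlankWork T = ∀ j → T (ι (just j)) ≈ emptyTape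

  rewind-halts : ∀ {n z} l w v T → T input ≈ at [] v → Rewinding l w (T claim) → Rewinding l w (T (ι nothing)) →
    BlankWork T →
    (∀ T → T input ≈ at [] v → T claim ≈ at [] (l ʳ++ w) → Starting M (l ʳ++ w) (λ i → T (ι i)) →
      Halts checker (run (start M)) T n z) →
    Halts checker rewind T (suc (length l) + n) z
  rewind-halts [] w v T at-v at-c at-r blank K =
    go (cong (onRewind (scan (T input))) (scan-rewinding [] w at-c))
      (K _ (keep {w = v} at-v) (rewind-end w at-c) (starting (rewind-end w at-r) (idle-blank ∘ blank)))
  rewind-halts (b ∷ l) w v T at-v at-c at-r blank K =
    go (cong (onRewind (scan (T input))) (scan-rewinding (b ∷ l) w at-c))
      (rewind-halts l (b ∷ w) v _ (keep {w = v} at-v) (rewind-letter b l w at-c) (rewind-letter b l w at-r) (idle-blank ∘ blank) K)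

  module _ {p r} (C : Computes M p r) where
    open CheckFunction r default

    -- The cost after parsing: rewinding, the run of `M`, one switching step, and the output of
    -- either the claim or the default.
    time : ℕ → ℕ
    time n = suc n + (⟦ p ⟧ n + suc (n + length default))

    parse-halts : ∀ {n} l y T → length l + length y ≤ n →
      T input ≈ at [] y → T claim ≈ at (List.map just l) [] → T (ι nothing) ≈ at (List.map just l) [] → BlankWork T →
      Halts checker parse T (suc (length y) + time n) (check l y)
    parse₁-halts : ∀ {n} l y T → suc (length l + length y) ≤ n →
      T input ≈ at [] y → T claim ≈ at (List.map just l) [] → T (ι nothing) ≈ at (List.map just l) [] → BlankWork T →
      Halts checker parse₁ T (suc (length y) + time n) (check₁ l y)

    default≤time : ∀ {n} → length default ≤ time n
    default≤time {n} = ≤-trans (m≤n+m _ n) (≤-trans (n≤1+n _) (≤-trans (m≤n+m _ (⟦ p ⟧ n)) (m≤n+m _ (suc n))))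

    parse-halts {n} l [] T l≤n at-y at-c at-r blank =
      go (cong (onParse (scan (T input))) (scan-at [] at-y)) (Halts-≤ (default≤time {n}) (failing-halts _))
    parse-halts {n} l (true ∷ y) T l≤n at-y at-c at-r blank =
      go (cong (onParse (scan (T input))) (scan-at (true ∷ y) at-y))
        (parse₁-halts l y _ (subst (_≤ n) (+-suc (length l) (length y)) l≤n)
          (erase-letter at-y) (append-nothing at-c) (append-nothing at-r) (idle-blank ∘ blank))
    parse-halts {n} l (false ∷ y) T l≤n at-y at-c at-r blank =
      go (cong (onParse (scan (T input))) (scan-at (false ∷ y) at-y))
        (Halts-≤ bound (rewind-halts l [] y _ (erase-letter at-y) (rewind-start l at-c) (rewind-start l at-r) (idle-blank ∘ blank)
          λ T at-y at-u st → run-halts (C u (λ i → T (ι i)) st) T u y (λ _ → ≈-refl) at-y at-u (m≤m+n _ _) (m≤n+m _ _)))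
      where
      u : Word
      u = l ʳ++ []

      u≤n : length u ≤ n
      u≤n = ≤-trans (≤-reflexive (trans (length-ʳ++ l) (+-identityʳ _))) (≤-trans (m≤m+n (length l) _) l≤n)

      bound : suc (length l) + (⟦ p ⟧ (length u) + suc (length u + length default)) ≤ suc (length y) + time n
      bound = ≤-trans
        (+-mono-≤ (s≤s (≤-trans (m≤m+n (length l) _) l≤n))
          (+-mono-≤ (⟦⟧-mono-≤ p u≤n) (s≤s (+-monoˡ-≤ (length default) u≤n))))
        (m≤n+m _ (suc (length y)))

    parse₁-halts {n} l [] T l≤n at-y at-c at-r blank =
      go (cong (onParse₁ (scan (T input))) (scan-at [] at-y)) (Halts-≤ (default≤time {n}) (failing-halts _))
    parse₁-halts {n} l (b ∷ y) T l≤n at-y at-c at-r blank =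
      go (cong (onParse₁ (scan (T input))) (scan-at (b ∷ y) at-y))
        (parse-halts (b ∷ l) y _ (≤-trans (n≤1+n _) (subst (λ k → suc k ≤ n) (+-suc (length l) (length y)) l≤n))
          (erase-letter at-y) (append-letter b l at-c) (append-letter b l at-r) (idle-blank ∘ blank))

    checkerᴾ : Polynomial
    checkerᴾ = constᴾ 1 +ᴾ idᴾ +ᴾ (constᴾ 1 +ᴾ idᴾ +ᴾ (p +ᴾ (constᴾ 1 +ᴾ (idᴾ +ᴾ constᴾ (length default)))))

    checkerᴾ-time : ∀ n → ⟦ checkerᴾ ⟧ n ≡ suc n + time n
    checkerᴾ-time n
      rewrite ⟦+ᴾ⟧ (constᴾ 1 +ᴾ idᴾ) (constᴾ 1 +ᴾ idᴾ +ᴾ (p +ᴾ (constᴾ 1 +ᴾ (idᴾ +ᴾ constᴾ (length default))))) n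
            | ⟦+ᴾ⟧ (constᴾ 1 +ᴾ idᴾ) (p +ᴾ (constᴾ 1 +ᴾ (idᴾ +ᴾ constᴾ (length default)))) n
            | ⟦+ᴾ⟧ p (constᴾ 1 +ᴾ (idᴾ +ᴾ constᴾ (length default))) n
      = arith n (⟦ p ⟧ n) (length default)
      where
      arith : ∀ n x d → (1 + n * (1 + n * 0)) + ((1 + n * (1 + n * 0)) + (x + (1 + (0 + d) + n * (1 + n * 0)))) ≡ suc n + (suc n + (x + suc (n + d)))
      arith = solve-∀

    checker-computes : Computes checker checkerᴾ (check [])
    checker-computes x T (starting at-x blank) = subst (λ n → Halts checker parse T n (check [] x))
      (sym (checkerᴾ-time (length x)))
      (parse-halts [] x T ≤-refl at-x (blank nothing) (blank (just nothing)) (λ j → blank (just (just j))))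

-- Machines realized by transducers

position : (X → Fin k) → Maybe X → Fin (suc k)
position f nothing  = zero
position f (just j) = suc (f j)

tapeAt : (Fin k → X) → Fin (suc k) → Maybe X
tapeAt g zero    = nothing
tapeAt g (suc i) = just (g i)

position-tapeAt : ∀ {f : X → Fin k} {g} → (∀ i → f (g i) ≡ i) → ∀ i → position f (tapeAt g i) ≡ i
position-tapeAt eq zero    = refl
position-tapeAt eq (suc i) = cong suc (eq i)

tapeAt-position : ∀ {f : X → Fin k} {g} → (∀ j → g (f j) ≡ j) → ∀ i → tapeAt g (position f i) ≡ i
tapeAt-position eq nothing  = refl
tapeAt-position eq (just j) = cong just (eq j)

pos : Maybe (Fin k) → Fin (suc k)
pos = position (λ i → i)

idx : Fin (suc k) → Maybe (Fin k)
idx = tapeAt (λ i → i)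

pos-idx : ∀ (i : Fin (suc k)) → pos (idx i) ≡ i
pos-idx = position-tapeAt (λ _ → refl)

module _ (M : Transducer) where
  open Transducer M using (extraTapes; states; tapes)

  respond : Action states tapes → Response (Fin states) (Fin extraTapes)
  respond α = next α , lookup (acts α) ∘ pos , emit α

  machine : Machine
  machine = record
    { State  = Fin states
    ; Work   = Fin extraTapes
    ; start  = zero
    ; δ      = λ s v → Maybe.map respond (Transducer.δ M s (tabulate (v ∘ idx)))
    ; δ-cong = λ s eq → cong (Maybe.map respond ∘ Transducer.δ M s) (tabulate-cong (eq ∘ idx))
    }

  open Config

  tapesOf : Config M → Tapes machine
  tapesOf c i = lookup (content c) (pos i)

  scans : ∀ c → tabulate ((scan ∘ tapesOf c) ∘ idx) ≡ Vec.map scan (content c)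
  scans c = trans
    (tabulate-cong λ i → trans (cong (scan ∘ lookup (content c)) (pos-idx i)) (sym (lookup-map i scan (content c))))
    (tabulate∘lookup _)

  -- A configuration accumulates its output, whereas `Halts` records only what is still to be
  -- emitted; `z` is that remainder.
  halts : ∀ {c t y} → HaltsIn M c t y → ∃[ z ] y ≡ output c ++ z × Halts machine (state c) (tapesOf c) t z
  halts {c} (halt e) = [] , sym (++-identityʳ _) ,
    stop (trans (cong (Maybe.map respond ∘ Transducer.δ M (state c)) (scans c)) (stuck (Transducer.δ M (state c) (Vec.map scan (content c))) e))
    where
    stuck : ∀ (x : Maybe (Action states tapes)) → Maybe.map (perform M c) x ≡ nothing → Maybe.map respond x ≡ nothing
    stuck nothing _ = refl
  halts {c} (move {c′} {t} {y} e h) = moving (Transducer.δ M (state c) (Vec.map scan (content c))) refl e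
    where
    moving : ∀ x → Transducer.δ M (state c) (Vec.map scan (content c)) ≡ x →
      Maybe.map (perform M c) x ≡ just c′ → ∃[ z ] y ≡ output c ++ z × Halts machine (state c) (tapesOf c) (suc t) z
    moving (just α) eq refl = let z , y≡ , h′ = halts h in
      fromMaybe (emit α) ++ z , trans y≡ (++-assoc (output c) (fromMaybe (emit α)) z) ,
      go (trans (cong (Maybe.map respond ∘ Transducer.δ M (state c)) (scans c)) (cong (Maybe.map respond) eq))
        (Halts-≈ (λ i → ≈-reflexive (lookup-zipWith writeMove (pos i) (acts α) (content c))) h′)

  machine-computes : ∀ {f} → ComputesInPolyTime M f → ∃[ p ] Computes machine p f
  machine-computes {f} (p , C) = p , λ x T st → let t , t≤ , h = C x ; z , y≡ , h′ = halts h in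
    subst (Halts machine zero T (⟦ p ⟧ (length x))) (sym y≡) (Halts-≤ t≤ (Halts-≈ (initially x T st) h′))
    where
    open Starting
    initially : ∀ x T → Starting machine x T → ∀ i → tapesOf (initial M x) i ≈ T i
    initially x T st nothing  = ≈-trans (≈-reflexive (inputTape≡at x)) (≈-sym (input st))
    initially x T st (just j) = ≈-trans (≈-reflexive (lookup-replicate j emptyTape)) (≈-sym (blank st j))

module _ (A : Machine) (M : Transducer) where
  open Transducer M using (extraTapes; states; tapes)

  -- The table is constrained only at states of the form `code s`; a run that begins at
  -- `code (start A)` never leaves them.
  record Realizes : Set where
    field
      code       : State A → Fin states
      code-start : code (start A) ≡ zero
      toWork     : Fin extraTapes → Work A
      fromWork   : Work A → Fin extraTapes
      toWork-fromWork : ∀ j → toWork (fromWork j) ≡ j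

    encode : Response (State A) (Work A) → Action states tapes
    encode (s , w , e) = action (code s) (tabulate (w ∘ tapeAt toWork)) e

    field
      δ-code : ∀ s v → Transducer.δ M (code s) v ≡ Maybe.map encode (δ A s (lookup v ∘ position fromWork))

  module _ (R : Realizes) where
    open Realizes R

    realized : ∀ {s T n y} → Halts A s T n y → ∀ c o → (∀ i → lookup c i ≡ T (tapeAt toWork i)) →
      ∃[ t ] t ≤ n × HaltsIn M (config (code s) c o) t (o ++ y)
    realized {s} {T} h c o eq = go-on h
      where
      open ≡-Reasoning
      scanned : lookup (Vec.map scan c) ∘ position fromWork ≗ scan ∘ T
      scanned i = begin
        lookup (Vec.map scan c) (position fromWork i)    ≡⟨ lookup-map (position fromWork i) scan c ⟩
        scan (lookup c (position fromWork i))            ≡⟨ cong scan (eq (position fromWork i)) ⟩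
        scan (T (tapeAt toWork (position fromWork i)))   ≡⟨ cong (scan ∘ T) (tapeAt-position toWork-fromWork i) ⟩
        scan (T i)                                       ∎

      reaction : ∀ {x} → δ A s (scan ∘ T) ≡ x → Transducer.δ M (code s) (Vec.map scan c) ≡ Maybe.map encode x
      reaction e = trans (δ-code s (Vec.map scan c)) (cong (Maybe.map encode) (trans (δ-cong A s scanned) e))

      go-on : ∀ {n y} → Halts A s T n y → ∃[ t ] t ≤ n × HaltsIn M (config (code s) c o) t (o ++ y)
      go-on (stop e) = 0 , z≤n , subst (HaltsIn M _ 0) (sym (++-identityʳ o))
        (halt (cong (Maybe.map (perform M (config (code s) c o))) (reaction e)))
      go-on (go {s′} {w} {e₁} {y = y} e h) =
        let t , t≤n , h′ = realized h _ (o ++ fromMaybe e₁) moved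
        in suc t , s≤s t≤n , subst (HaltsIn M _ (suc t)) (++-assoc o (fromMaybe e₁) y)
             (move (cong (Maybe.map (perform M (config (code s) c o))) (reaction e)) h′)
        where
        moved : ∀ i → lookup (Vec.zipWith writeMove (tabulate (w ∘ tapeAt toWork)) c) i ≡
          writeMove (w (tapeAt toWork i)) (T (tapeAt toWork i))
        moved i = trans (lookup-zipWith writeMove i (tabulate (w ∘ tapeAt toWork)) c)
          (cong₂ writeMove (lookup∘tabulate (w ∘ tapeAt toWork) i) (eq i))

    realizes-computes : ∀ {p f} → Computes A p f → ComputesInPolyTime M f
    realizes-computes {p} C = p , λ x →
      let T = started x
          t , t≤ , h = realized (C x T (starting (≈-reflexive (inputTape≡at x)) (λ _ → ≈-refl))) (contents x) [] (begun x)
      in t , t≤ , subst (λ s → HaltsIn M (config s (contents x) []) t _) code-start h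
      where
      started : Word → Tapes A
      started x nothing  = inputTape x
      started x (just j) = emptyTape

      contents : Word → Vec Tape tapes
      contents x = inputTape x ∷ replicate extraTapes emptyTape

      begun : ∀ x i → lookup (contents x) i ≡ started x (tapeAt toWork i)
      begun x zero    = refl
      begun x (suc i) = lookup-replicate i emptyTape

-- Together with `emitOf` these undo `valueCode`: the entries of a given table are available only as
-- numbers and must be taken apart arithmetically.
nextOf actsOf : ℕ → ℕ → ℕ
nextOf k x = (pred x ÷ 3) ÷ 9 ^ k
actsOf k x = (pred x ÷ 3) mod′ 9 ^ k

emitOf : ℕ → ℕ
emitOf x = pred x mod′ 3

module _ (α : Action m k) where
  private
    p w e : ℕ
    p = toℕ (next α)
    w = acts# (lookup (acts α))
    e = toℕ (fromSymbol (emit α))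

    w< : w < 9 ^ k
    w< = number< (fromAct ∘ lookup (acts α))

    ÷3 : ((p * 9 ^ k + w) * 3 + e) ÷ 3 ≡ p * 9 ^ k + w
    ÷3 = a*n+b÷n≡a (p * 9 ^ k + w) (toℕ<n (fromSymbol (emit α)))

  nextOf-actionCode : nextOf k (actionCode (just α)) ≡ p
  nextOf-actionCode = trans (cong (_÷ 9 ^ k) ÷3) (a*n+b÷n≡a p w<)

  actsOf-actionCode : actsOf k (actionCode (just α)) ≡ w
  actsOf-actionCode = trans (cong (_mod′ 9 ^ k) ÷3) (a*n+b-mod′-n≡b p w<)

  emitOf-actionCode : emitOf (actionCode (just α)) ≡ e
  emitOf-actionCode = a*n+b-mod′-n≡b (p * 9 ^ k + w) (toℕ<n (fromSymbol (emit α)))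

valueCode-cong : ∀ k {p p′ w w′ e e′} → p ≡ p′ → w ≡ w′ → e ≡ e′ → valueCode k p w e ≡ valueCode k p′ w′ e′
valueCode-cong k refl refl refl = refl

acts#-lookup-tabulate : (w : Fin k → Symbol × Move) → acts# (lookup (tabulate w)) ≡ acts# w
acts#-lookup-tabulate w = number-cong (λ i → cong fromAct (lookup∘tabulate w i))

acts#-pos-idx : (w : Vec (Symbol × Move) (suc k)) → acts# (lookup w ∘ pos ∘ idx) ≡ acts# (lookup w)
acts#-pos-idx w = number-cong (λ i → cong (fromAct ∘ lookup w) (pos-idx i))

acts#-idle : ∀ k → acts# {k} (λ _ → idle) ≡ 0
acts#-idle k = number-constant k (fromAct idle) refl

acts#-only : ∀ k a → acts# {suc k} (only a ∘ idx) ≡ toℕ (fromAct a) * 9 ^ k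
acts#-only k a = trans (number-∷ (fromAct ∘ only a ∘ idx {k}))
  (trans (cong (toℕ (fromAct a) * 9 ^ k +_) (acts#-idle k)) (+-identityʳ _))

symbols-tabulate : ∀ {v : Fin k → Symbol} {u} → v ≗ u → symbols (lookup (tabulate v)) ≡ symbols u
symbols-tabulate {v = v} eq = number-cong (λ i → cong fromSymbol (trans (lookup∘tabulate v i) (eq i)))

if0-zero : ∀ {z} a b → z ≡ 0 → if0 z then a else b ≡ a
if0-zero a b refl = refl

if0-suc : ∀ {z i} a b → z ≡ suc i → if0 z then a else b ≡ b
if0-suc a b refl = refl

if0-< : ∀ {s m} a b → s < m → if0 suc s ∸ m then a else b ≡ a
if0-< a b s<m rewrite m≤n⇒m∸n≡0 s<m = refl

if0-≥ : ∀ m i a b → if0 suc (m + i) ∸ m then a else b ≡ b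
if0-≥ m i a b rewrite sym (+-suc m i) | m+n∸m≡n m (suc i) = refl

-- Codes of composed and dispatching transducers

module _ (q₁ k₁ t₁ q₂ k₂ t₂ : ℕ) where

  -- The states of `M₁` come first, then `rewind` with number `suc q₁`, then those of `M₂`. The
  -- shared input and the work tapes of `M₁` precede all `suc k₂` tapes of `M₂`.
  sequenceStates sequenceTapes : ℕ
  sequenceStates = q₁ + suc (suc q₂)
  sequenceTapes  = k₁ + suc k₂

  -- An act has code 3 times the symbol plus the move, with left, stay, right as 0, 1, 2. So 1 is a
  -- blank and stay, `emitOf x * 3 + 2` writes the emitted bit and moves right, and `9 ^ k₂` places
  -- this act on the input tape of `M₂`.
  sequence₁# : ℕ → ℕ
  sequence₁# x = if0 x
    then valueCode (suc sequenceTapes) (suc q₁) 0 0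
    else valueCode (suc sequenceTapes) (nextOf (suc k₁) x)
           (actsOf (suc k₁) x * 9 ^ suc k₂ + (if0 emitOf x then 1 else (emitOf x * 3 + 2)) * 9 ^ k₂) 0

  sequenceᵣ# : ℕ → ℕ
  sequenceᵣ# a = if0 a
    then valueCode (suc sequenceTapes) (suc (suc q₁)) (2 * 9 ^ k₂) 0
    else valueCode (suc sequenceTapes) (suc q₁) (a * 3 * 9 ^ k₂) 0

  sequence₂# : ℕ → ℕ
  sequence₂# x = if0 x
    then 0
    -- The tapes in front of those of `M₂` idle, which adds leading zeros, so the number of the acts
    -- is taken over as it is.
    else valueCode (suc sequenceTapes) (suc (suc q₁) + nextOf (suc k₂) x) (actsOf (suc k₂) x) (emitOf x)

  sequence# : ℕ → ℕ → ℕ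
  sequence# s v =
    -- Truncated subtraction serves as comparison: this difference is 0 exactly when `s` is a state
    -- of `M₁`, and the next one then singles out `rewind`.
    if0 suc s ∸ suc q₁ then sequence₁# (valueAt (suc q₁) (suc k₁) t₁ s (v ÷ 3 ^ suc k₂)) else
    if0 s ∸ suc q₁ then sequenceᵣ# ((v mod′ 3 ^ suc k₂) ÷ 3 ^ k₂) else
    sequence₂# (valueAt (suc q₂) (suc k₂) t₂ (s ∸ suc (suc q₁)) (v mod′ 3 ^ suc k₂))

  sequenceTransducer : Transducer
  sequenceTransducer = transducer sequenceStates sequenceTapes
    (toδ (table (suc sequenceStates) (suc sequenceTapes) sequence#))

  private
    M₁ M₂ : Transducer
    M₁ = transducer q₁ k₁ (toδ t₁)
    M₂ = transducer q₂ k₂ (toδ t₂)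

  open Sequence (machine M₁) (machine M₂)

  private
    toW : Fin sequenceTapes → W
    toW i = Sum.map₂ idx (splitAt k₁ i)

    fromW : W → Fin sequenceTapes
    fromW (inj₁ j) = j ↑ˡ suc k₂
    fromW (inj₂ i) = k₁ ↑ʳ pos i

    toW-fromW : ∀ j → toW (fromW j) ≡ j
    toW-fromW (inj₁ j) = cong (Sum.map₂ idx) (splitAt-↑ˡ k₁ j (suc k₂))
    toW-fromW (inj₂ i) = trans (cong (Sum.map₂ idx) (splitAt-↑ʳ k₁ (suc k₂) (pos i)))
      (cong inj₂ (tapeAt-position (λ _ → refl) i))

    stateCode : S → Fin (suc sequenceStates)
    stateCode (run₁ s) = s ↑ˡ suc (suc q₂)
    stateCode rewind   = suc q₁ ↑ʳ zero
    stateCode (run₂ s) = suc q₁ ↑ʳ suc s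

    encode : Response S W → Action (suc sequenceStates) (suc sequenceTapes)
    encode (s , w , e) = action (stateCode s) (tabulate (w ∘ tapeAt toW)) e

    acts#-both : ∀ w₁ w₂ → acts# (lookup (tabulate (both w₁ w₂ ∘ tapeAt toW))) ≡
      acts# (w₁ ∘ idx) * 9 ^ suc k₂ + acts# (w₂ ∘ idx)
    acts#-both w₁ w₂ = trans (acts#-lookup-tabulate (both w₁ w₂ ∘ tapeAt toW))
      (trans (number-++ (suc k₁) (fromAct ∘ both w₁ w₂ ∘ tapeAt toW))
        (cong₂ (λ a b → a * 9 ^ suc k₂ + b) (number-cong left-part) (number-cong right-part)))
      where
      left-part : ∀ i → fromAct (both w₁ w₂ (tapeAt toW (i ↑ˡ suc k₂))) ≡ fromAct (w₁ (idx i))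
      left-part zero    = refl
      left-part (suc i) = cong (fromAct ∘ both w₁ w₂ ∘ just) (toW-fromW (inj₁ i))

      right-part : ∀ i → fromAct (both w₁ w₂ (tapeAt toW (suc k₁ ↑ʳ i))) ≡ fromAct (w₂ (idx i))
      right-part i = cong (λ i → fromAct (both w₁ w₂ (just (Sum.map₂ idx i)))) (splitAt-↑ʳ k₁ (suc k₂) i)

    record# : ∀ e → toℕ (fromAct (record-emission e)) ≡
      (if0 toℕ (fromSymbol e) then 1 else (toℕ (fromSymbol e) * 3 + 2))
    record# nothing      = refl
    record# (just false) = refl
    record# (just true)  = refl

    response₁# : ∀ x → sequence₁# (actionCode x) ≡ actionCode (Maybe.map encode (response₁ (Maybe.map (respond M₁) x)))
    response₁# nothing = valueCode-cong (suc sequenceTapes)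
      (sym (trans (toℕ-↑ʳ (suc q₁) zero) (+-identityʳ _)))
      (sym (trans (acts#-both idles idles) (cong₂ (λ a b → a * 9 ^ suc k₂ + b) (acts#-idle (suc k₁)) (acts#-idle (suc k₂)))))
      refl
    response₁# (just α@(action p w e)) = valueCode-cong (suc sequenceTapes)
      (trans (nextOf-actionCode α) (sym (toℕ-↑ˡ p (suc (suc q₂)))))
      (sym (trans (acts#-both (lookup w ∘ pos) (only (record-emission e))) (cong₂ (λ a b → a * 9 ^ suc k₂ + b)
        (trans (acts#-pos-idx w) (sym (actsOf-actionCode α)))
        (trans (acts#-only k₂ (record-emission e)) (cong (_* 9 ^ k₂) (trans (record# e)
          (cong (λ e → if0 e then 1 else (e * 3 + 2)) (sym (emitOf-actionCode α)))))))))
      refl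

    responseᵣ# : ∀ a → sequenceᵣ# (toℕ (fromSymbol a)) ≡ actionCode (Maybe.map encode (responseᵣ a))
    responseᵣ# nothing = valueCode-cong (suc sequenceTapes)
      (sym (trans (toℕ-↑ʳ (suc q₁) (suc zero)) (+-comm (suc q₁) 1)))
      (sym (trans (acts#-both idles (only erase)) (cong₂ (λ a b → a * 9 ^ suc k₂ + b) (acts#-idle (suc k₁)) (acts#-only k₂ erase))))
      refl
    responseᵣ# (just b) = trans (positive b) (valueCode-cong (suc sequenceTapes)
      (sym (trans (toℕ-↑ʳ (suc q₁) zero) (+-identityʳ _)))
      (sym (trans (acts#-both idles (only (just b , left))) (cong₂ (λ a b → a * 9 ^ suc k₂ + b) (acts#-idle (suc k₁))
        (trans (acts#-only k₂ (just b , left)) (cong (_* 9 ^ k₂) (leftward b))))))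
      refl)
      where
      positive : ∀ b → sequenceᵣ# (toℕ (fromSymbol (just b))) ≡
        valueCode (suc sequenceTapes) (suc q₁) (toℕ (fromSymbol (just b)) * 3 * 9 ^ k₂) 0
      positive false = refl
      positive true  = refl

      leftward : ∀ b → toℕ (fromAct (just b , left)) ≡ toℕ (fromSymbol (just b)) * 3
      leftward false = refl
      leftward true  = refl

    response₂# : ∀ x → sequence₂# (actionCode x) ≡ actionCode (Maybe.map encode (response₂ (Maybe.map (respond M₂) x)))
    response₂# nothing = refl
    response₂# (just α@(action p w e)) = valueCode-cong (suc sequenceTapes)
      (trans (cong (suc (suc q₁) +_) (nextOf-actionCode α))
        (sym (trans (toℕ-↑ʳ (suc q₁) (suc p)) (+-suc (suc q₁) (toℕ p)))))
      (sym (trans (acts#-both idles (lookup w ∘ pos)) (cong₂ (λ a b → a * 9 ^ suc k₂ + b) (acts#-idle (suc k₁))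
        (trans (acts#-pos-idx w) (sym (actsOf-actionCode α))))))
      (emitOf-actionCode α)

    module _ (vec : Vec Symbol (suc sequenceTapes)) where

      v : Maybe W → Symbol
      v = lookup vec ∘ position fromW

      vec₁ : Vec Symbol (suc k₁)
      vec₁ = tabulate ((v ∘ ι₁) ∘ idx)

      vec₂ : Vec Symbol (suc k₂)
      vec₂ = tabulate ((v ∘ ι₂) ∘ idx)

      v# : ℕ
      v# = symbols (lookup vec)

      split : v# ≡ symbols (lookup vec₁) * 3 ^ suc k₂ + symbols (lookup vec₂)
      split = trans (number-++ (suc k₁) (fromSymbol ∘ lookup vec)) (cong₂ (λ a b → a * 3 ^ suc k₂ + b)
        (sym (symbols-tabulate left-part)) (sym (symbols-tabulate right-part)))
        where
        left-part : ∀ i → v (ι₁ (idx i)) ≡ lookup vec (i ↑ˡ suc k₂)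
        left-part zero    = refl
        left-part (suc i) = refl

        right-part : ∀ i → v (ι₂ (idx i)) ≡ lookup vec (suc k₁ ↑ʳ i)
        right-part i = cong (λ i → lookup vec (suc (k₁ ↑ʳ i))) (pos-idx i)

      vec₂< : symbols (lookup vec₂) < 3 ^ suc k₂
      vec₂< = number< (fromSymbol ∘ lookup vec₂)

      first : v# ÷ 3 ^ suc k₂ ≡ symbols (lookup vec₁)
      first = trans (cong (_÷ 3 ^ suc k₂) split) (a*n+b÷n≡a (symbols (lookup vec₁)) vec₂<)

      second : v# mod′ 3 ^ suc k₂ ≡ symbols (lookup vec₂)
      second = trans (cong (_mod′ 3 ^ suc k₂) split) (a*n+b-mod′-n≡b (symbols (lookup vec₁)) vec₂<)

      head₂ : symbols (lookup vec₂) ÷ 3 ^ k₂ ≡ toℕ (fromSymbol (v (ι₂ nothing)))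
      head₂ = trans (cong (_÷ 3 ^ k₂) (number-∷ (fromSymbol ∘ lookup vec₂)))
        (a*n+b÷n≡a (toℕ (fromSymbol (v (ι₂ nothing)))) (number< (fromSymbol ∘ lookup vec₂ ∘ suc)))

      open ≡-Reasoning

      sequence#-correct : ∀ s → sequence# (toℕ (stateCode s)) v# ≡ actionCode (Maybe.map encode (δˢ s v))
      sequence#-correct (run₁ s) = begin
        sequence# (toℕ (s ↑ˡ suc (suc q₂))) v#
          ≡⟨ cong (λ s → sequence# s v#) (toℕ-↑ˡ s (suc (suc q₂))) ⟩
        sequence# (toℕ s) v#
          ≡⟨ if0-< {m = suc q₁} _ _ (toℕ<n s) ⟩
        sequence₁# (valueAt (suc q₁) (suc k₁) t₁ (toℕ s) (v# ÷ 3 ^ suc k₂))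
          ≡⟨ cong (λ v → sequence₁# (valueAt (suc q₁) (suc k₁) t₁ (toℕ s) v)) first ⟩
        sequence₁# (valueAt (suc q₁) (suc k₁) t₁ (toℕ s) (symbols (lookup vec₁)))
          ≡⟨ cong sequence₁# (valueAt-toδ t₁ s vec₁) ⟩
        sequence₁# (actionCode (toδ t₁ s vec₁))
          ≡⟨ response₁# (toδ t₁ s vec₁) ⟩
        actionCode (Maybe.map encode (δˢ (run₁ s) v)) ∎
      sequence#-correct rewind = begin
        sequence# (toℕ (suc q₁ ↑ʳ zero {suc q₂})) v#
          ≡⟨ cong (λ s → sequence# s v#) (toℕ-↑ʳ (suc q₁) (zero {suc q₂})) ⟩
        sequence# (suc q₁ + 0) v#
          ≡⟨ trans (if0-≥ (suc q₁) 0 _ _) (if0-zero _ _ (m+n∸m≡n (suc q₁) 0)) ⟩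
        sequenceᵣ# ((v# mod′ 3 ^ suc k₂) ÷ 3 ^ k₂)
          ≡⟨ cong sequenceᵣ# (trans (cong (_÷ 3 ^ k₂) second) head₂) ⟩
        sequenceᵣ# (toℕ (fromSymbol (v (ι₂ nothing))))
          ≡⟨ responseᵣ# (v (ι₂ nothing)) ⟩
        actionCode (Maybe.map encode (δˢ rewind v)) ∎
      sequence#-correct (run₂ s) = begin
        sequence# (toℕ (suc q₁ ↑ʳ suc s)) v#
          ≡⟨ cong (λ s → sequence# s v#) (toℕ-↑ʳ (suc q₁) (suc s)) ⟩
        sequence# (suc q₁ + suc (toℕ s)) v#
          ≡⟨ trans (if0-≥ (suc q₁) (suc (toℕ s)) _ _) (if0-suc _ _ (m+n∸m≡n (suc q₁) (suc (toℕ s)))) ⟩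
        sequence₂# (valueAt (suc q₂) (suc k₂) t₂ (suc q₁ + suc (toℕ s) ∸ suc (suc q₁)) (v# mod′ 3 ^ suc k₂))
          ≡⟨ cong₂ (λ s v → sequence₂# (valueAt (suc q₂) (suc k₂) t₂ s v))
               (trans (cong (_∸ suc (suc q₁)) (+-suc (suc q₁) (toℕ s))) (m+n∸m≡n (suc (suc q₁)) (toℕ s))) second ⟩
        sequence₂# (valueAt (suc q₂) (suc k₂) t₂ (toℕ s) (symbols (lookup vec₂)))
          ≡⟨ cong sequence₂# (valueAt-toδ t₂ s vec₂) ⟩
        sequence₂# (actionCode (toδ t₂ s vec₂))
          ≡⟨ response₂# (toδ t₂ s vec₂) ⟩
        actionCode (Maybe.map encode (δˢ (run₂ s) v)) ∎

  sequence-realized : Realizes sequence sequenceTransducer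
  sequence-realized = record
    { code            = stateCode
    ; code-start      = refl
    ; toWork          = toW
    ; fromWork        = fromW
    ; toWork-fromWork = toW-fromW
    ; δ-code          = λ s vec → toδ-table sequence# (stateCode s) vec _ (sequence#-correct vec s)
    }

module _ (paired# q₁ k₁ t₁ q₂ k₂ t₂ : ℕ) where

  -- `seen` and `seen1` are numbered 0 and 1, the states of `M₁` start at 2 and those of `M₂` at
  -- `2 + suc q₁`. Both components share the input tape, which is followed by the `k₁` and then the
  -- `k₂` work tapes.
  dispatchStates dispatchTapes : ℕ
  dispatchStates = 1 + (suc q₁ + suc q₂)
  dispatchTapes  = k₁ + k₂

  consume# : ℕ → ℕ → ℕ
  consume# s e = valueCode (suc dispatchTapes) s (2 * 9 ^ dispatchTapes) e

  onSeen# : ℕ → ℕ → ℕ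
  onSeen# p a = if0 a
    then (if0 p then consume# 2 0 else 0)
    -- The letters `false` and `true` have codes 1 and 2, so the predecessor is 0 exactly for
    -- `false`.
    else (if0 pred a
      then consume# 2 p
      else (if0 p then consume# (2 + suc q₁) 0 else consume# 1 2))

  onSeen1# dispatch₁# dispatch₂# : ℕ → ℕ
  onSeen1# a = if0 a then 0 else consume# 0 a
  dispatch₁# x = if0 x
    then 0
    else valueCode (suc dispatchTapes) (2 + nextOf (suc k₁) x) (actsOf (suc k₁) x * 9 ^ k₂) (emitOf x)
  dispatch₂# x = if0 x
    then 0
    else valueCode (suc dispatchTapes) (2 + (suc q₁ + nextOf (suc k₂) x))
           -- The act on the shared input tape is split off and moved to the top digit, which
           -- inserts `k₁` zeros for the idle work tapes of `M₁`.
           ((actsOf (suc k₂) x ÷ 9 ^ k₂) * 9 ^ dispatchTapes + actsOf (suc k₂) x mod′ 9 ^ k₂) (emitOf x)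

  dispatcher# : ℕ → ℕ → ℕ
  dispatcher# s v =
    if0 s     then onSeen# paired# (v ÷ 3 ^ dispatchTapes) else
    if0 s ∸ 1 then onSeen1# (v ÷ 3 ^ dispatchTapes) else
    -- With `s = 2 + s′` this is `suc s′ ∸ suc q₁`, which is 0 exactly when `s′` is a state of `M₁`.
    if0 s ∸ 1 ∸ suc q₁
      then dispatch₁# (valueAt (suc q₁) (suc k₁) t₁ (s ∸ 2) (v ÷ 3 ^ k₂))
      else dispatch₂# (valueAt (suc q₂) (suc k₂) t₂ (s ∸ 2 ∸ suc q₁)
                        -- The symbols that `M₂` sees: the top digit for the input, then the last
                        -- `k₂` digits, with the work tapes of `M₁` cut out.
                        ((v ÷ 3 ^ dispatchTapes) * 3 ^ k₂ + v mod′ 3 ^ k₂))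

  dispatchTransducer : Transducer
  dispatchTransducer = transducer dispatchStates dispatchTapes
    (toδ (table (suc dispatchStates) (suc dispatchTapes) dispatcher#))

  private
    M₁ M₂ : Transducer
    M₁ = transducer q₁ k₁ (toδ t₁)
    M₂ = transducer q₂ k₂ (toδ t₂)

  -- `paired#` doubles as the code of the emission `just false`.
  module _ (paired : Bool) (paired#-correct : paired# ≡ (if paired then 1 else 0)) where
    open Dispatch paired (machine M₁) (machine M₂)
    private
      toW : Fin dispatchTapes → W
      toW = splitAt k₁

      fromW : W → Fin dispatchTapes
      fromW = join k₁ k₂

      stateCode : S → Fin (suc dispatchStates)
      stateCode seen     = zero
      stateCode seen1    = suc zero
      stateCode (run₁ s) = suc (suc (s ↑ˡ suc q₂))
      stateCode (run₂ s) = suc (suc (suc q₁ ↑ʳ s))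

      encode : Response S W → Action (suc dispatchStates) (suc dispatchTapes)
      encode (s , w , e) = action (stateCode s) (tabulate (w ∘ tapeAt toW)) e

      9^+ : 9 ^ dispatchTapes ≡ 9 ^ k₁ * 9 ^ k₂
      9^+ = ^-distribˡ-+-* 9 k₁ k₂

      acts#-parts : ∀ w a u₁ u₂ → w nothing ≡ a → (∀ j → w (just (inj₁ j)) ≡ u₁ j) → (∀ j → w (just (inj₂ j)) ≡ u₂ j) →
        acts# (lookup (tabulate (w ∘ tapeAt toW))) ≡
        toℕ (fromAct a) * 9 ^ dispatchTapes + (acts# u₁ * 9 ^ k₂ + acts# u₂)
      acts#-parts w a u₁ u₂ eqᵢ eq₁ eq₂ = trans (acts#-lookup-tabulate (w ∘ tapeAt toW))
        (trans (number-∷ (fromAct ∘ w ∘ tapeAt toW)) (cong₂ (λ a b → a * 9 ^ dispatchTapes + b) (cong (toℕ ∘ fromAct) eqᵢ)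
          (trans (number-++ k₁ (fromAct ∘ w ∘ just ∘ toW)) (cong₂ (λ a b → a * 9 ^ k₂ + b)
            (number-cong (λ j → cong fromAct (trans (cong (w ∘ just) (splitAt-↑ˡ k₁ j k₂)) (eq₁ j))))
            (number-cong (λ j → cong fromAct (trans (cong (w ∘ just) (splitAt-↑ʳ k₁ k₂ j)) (eq₂ j))))))))

      acts#-erase : acts# (lookup (tabulate (only erase ∘ tapeAt toW))) ≡ 2 * 9 ^ dispatchTapes
      acts#-erase = trans (acts#-parts (only erase) erase (λ _ → idle) (λ _ → idle) refl (λ _ → refl) (λ _ → refl))
        (trans (cong₂ (λ a b → 2 * 9 ^ dispatchTapes + (a * 9 ^ k₂ + b)) (acts#-idle k₁) (acts#-idle k₂)) (+-identityʳ _))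

      acts#-∷ : ∀ {k} (w : Vec (Symbol × Move) (suc k)) →
        acts# (lookup w) ≡ toℕ (fromAct (lookup w zero)) * 9 ^ k + acts# (lookup w ∘ suc)
      acts#-∷ w = number-∷ (fromAct ∘ lookup w)

      acts#-extend₁ : ∀ w → acts# (lookup (tabulate (extend₁ (lookup w ∘ pos) ∘ tapeAt toW))) ≡ acts# (lookup w) * 9 ^ k₂
      acts#-extend₁ w = begin
        acts# (lookup (tabulate (extend₁ (lookup w ∘ pos) ∘ tapeAt toW)))
          ≡⟨ acts#-parts (extend₁ (lookup w ∘ pos)) (lookup w zero) (lookup w ∘ suc) (λ _ → idle) refl (λ _ → refl) (λ _ → refl) ⟩
        a * 9 ^ dispatchTapes + (others * 9 ^ k₂ + acts# {k₂} (λ _ → idle))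
          ≡⟨ cong₂ (λ p c → a * p + (others * 9 ^ k₂ + c)) 9^+ (acts#-idle k₂) ⟩
        a * (9 ^ k₁ * 9 ^ k₂) + (others * 9 ^ k₂ + 0)
          ≡⟨ cong₂ _+_ (sym (*-assoc a (9 ^ k₁) (9 ^ k₂))) (+-identityʳ (others * 9 ^ k₂)) ⟩
        a * 9 ^ k₁ * 9 ^ k₂ + others * 9 ^ k₂
          ≡⟨ *-distribʳ-+ (9 ^ k₂) (a * 9 ^ k₁) others ⟨
        (a * 9 ^ k₁ + others) * 9 ^ k₂
          ≡⟨ cong (_* 9 ^ k₂) (acts#-∷ w) ⟨
        acts# (lookup w) * 9 ^ k₂ ∎
        where
        open ≡-Reasoning
        a others : ℕ
        a = toℕ (fromAct (lookup w zero))
        others = acts# (lookup w ∘ suc)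

      acts#-extend₂ : ∀ w → acts# (lookup (tabulate (extend₂ (lookup w ∘ pos) ∘ tapeAt toW))) ≡
        (acts# (lookup w) ÷ 9 ^ k₂) * 9 ^ dispatchTapes + acts# (lookup w) mod′ 9 ^ k₂
      acts#-extend₂ w = begin
        acts# (lookup (tabulate (extend₂ (lookup w ∘ pos) ∘ tapeAt toW)))
          ≡⟨ acts#-parts (extend₂ (lookup w ∘ pos)) (lookup w zero) (λ _ → idle) (lookup w ∘ suc) refl (λ _ → refl) (λ _ → refl) ⟩
        a * 9 ^ dispatchTapes + (acts# {k₁} (λ _ → idle) * 9 ^ k₂ + others)
          ≡⟨ cong (λ c → a * 9 ^ dispatchTapes + (c * 9 ^ k₂ + others)) (acts#-idle k₁) ⟩
        a * 9 ^ dispatchTapes + others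
          ≡⟨ cong₂ (λ a b → a * 9 ^ dispatchTapes + b)
               (trans (cong (_÷ 9 ^ k₂) (acts#-∷ w)) (a*n+b÷n≡a a others<))
               (trans (cong (_mod′ 9 ^ k₂) (acts#-∷ w)) (a*n+b-mod′-n≡b a others<)) ⟨
        (acts# (lookup w) ÷ 9 ^ k₂) * 9 ^ dispatchTapes + acts# (lookup w) mod′ 9 ^ k₂ ∎
        where
        open ≡-Reasoning
        a others : ℕ
        a = toℕ (fromAct (lookup w zero))
        others = acts# (lookup w ∘ suc)
        others< : others < 9 ^ k₂
        others< = number< (fromAct ∘ lookup w ∘ suc)

      response : Maybe (Response S W) → ℕ
      response x = actionCode (Maybe.map encode x)

      consumed : ∀ s {s#} e {e#} → toℕ (stateCode s) ≡ s# → toℕ (fromSymbol e) ≡ e# → consume# s# e# ≡ response (consume s e)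
      consumed s e eqₛ eqₑ = valueCode-cong (suc dispatchTapes) (sym eqₛ) (sym acts#-erase) (sym eqₑ)

      onSeen#-correct : ∀ p a → onSeen# (if p then 1 else 0) (toℕ (fromSymbol a)) ≡ response (onSeen p a)
      onSeen#-correct true  nothing      = refl
      onSeen#-correct true  (just false) = consumed (run₁ zero) (just false) refl refl
      onSeen#-correct true  (just true)  = consumed seen1 (just true) refl refl
      onSeen#-correct false nothing      = consumed (run₁ zero) nothing refl refl
      onSeen#-correct false (just false) = consumed (run₁ zero) nothing refl refl
      onSeen#-correct false (just true)  =
        consumed (run₂ zero) nothing (cong (2 +_) (trans (toℕ-↑ʳ (suc q₁) (zero {q₂})) (+-identityʳ _))) refl

      onSeen1#-correct : ∀ a → onSeen1# (toℕ (fromSymbol a)) ≡ response (onSeen1 a)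
      onSeen1#-correct nothing      = refl
      onSeen1#-correct (just false) = consumed seen (just false) refl refl
      onSeen1#-correct (just true)  = consumed seen (just true) refl refl

      response₁# : ∀ x → dispatch₁# (actionCode x) ≡ response (response₁ (Maybe.map (respond M₁) x))
      response₁# nothing = refl
      response₁# (just α@(action p w e)) = valueCode-cong (suc dispatchTapes)
        (cong (2 +_) (trans (nextOf-actionCode α) (sym (toℕ-↑ˡ p (suc q₂)))))
        (trans (cong (_* 9 ^ k₂) (actsOf-actionCode α)) (sym (acts#-extend₁ w)))
        (emitOf-actionCode α)

      response₂# : ∀ x → dispatch₂# (actionCode x) ≡ response (response₂ (Maybe.map (respond M₂) x))
      response₂# nothing = refl
      response₂# (just α@(action p w e)) = valueCode-cong (suc dispatchTapes)
        (cong (2 +_) (trans (cong (suc q₁ +_) (nextOf-actionCode α)) (sym (toℕ-↑ʳ (suc q₁) p))))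
        (trans (cong (λ w → (w ÷ 9 ^ k₂) * 9 ^ dispatchTapes + w mod′ 9 ^ k₂) (actsOf-actionCode α)) (sym (acts#-extend₂ w)))
        (emitOf-actionCode α)

      module _ (vec : Vec Symbol (suc dispatchTapes)) where

        v : Maybe W → Symbol
        v = lookup vec ∘ position fromW

        vec₁ : Vec Symbol (suc k₁)
        vec₁ = tabulate ((v ∘ ι₁) ∘ idx)

        vec₂ : Vec Symbol (suc k₂)
        vec₂ = tabulate ((v ∘ ι₂) ∘ idx)

        v# a others : ℕ
        v# = symbols (lookup vec)
        a  = toℕ (fromSymbol (lookup vec zero))
        others  = symbols (λ j → lookup vec (suc (k₁ ↑ʳ j)))

        others< : others < 3 ^ k₂
        others< = number< (λ j → fromSymbol (lookup vec (suc (k₁ ↑ʳ j))))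

        first : v# ÷ 3 ^ k₂ ≡ symbols (lookup vec₁)
        first = trans (cong (_÷ 3 ^ k₂) (number-++ (suc k₁) (fromSymbol ∘ lookup vec)))
          (trans (a*n+b÷n≡a (symbols (λ i → lookup vec (i ↑ˡ k₂))) others<) (sym (symbols-tabulate left-part)))
          where
          left-part : ∀ i → v (ι₁ (idx i)) ≡ lookup vec (i ↑ˡ k₂)
          left-part zero    = refl
          left-part (suc i) = refl

        input# : v# ÷ 3 ^ dispatchTapes ≡ a
        input# = trans (cong (_÷ 3 ^ dispatchTapes) (number-∷ (fromSymbol ∘ lookup vec)))
          (a*n+b÷n≡a a (number< (fromSymbol ∘ lookup vec ∘ suc)))

        second : (v# ÷ 3 ^ dispatchTapes) * 3 ^ k₂ + v# mod′ 3 ^ k₂ ≡ symbols (lookup vec₂)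
        second = trans
          (cong₂ (λ a b → a * 3 ^ k₂ + b) input#
            (trans (cong (_mod′ 3 ^ k₂) (number-++ (suc k₁) (fromSymbol ∘ lookup vec))) (a*n+b-mod′-n≡b (symbols (λ i → lookup vec (i ↑ˡ k₂))) others<)))
          (sym (trans (number-∷ (fromSymbol ∘ lookup vec₂))
            (cong (a * 3 ^ k₂ +_) (symbols-tabulate {v = v ∘ ι₂ ∘ just} (λ _ → refl)))))

        open ≡-Reasoning

        dispatcher#-correct : ∀ s → dispatcher# (toℕ (stateCode s)) v# ≡ response (δᵈ s v)
        dispatcher#-correct seen  = trans (cong₂ onSeen# paired#-correct input#) (onSeen#-correct paired (v nothing))
        dispatcher#-correct seen1 = trans (cong onSeen1# input#) (onSeen1#-correct (v nothing))
        dispatcher#-correct (run₁ s) = begin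
          dispatcher# (2 + toℕ (s ↑ˡ suc q₂)) v#
            ≡⟨ cong (λ s → dispatcher# (2 + s) v#) (toℕ-↑ˡ s (suc q₂)) ⟩
          dispatcher# (2 + toℕ s) v#
            ≡⟨ if0-< {m = suc q₁} _ _ (toℕ<n s) ⟩
          dispatch₁# (valueAt (suc q₁) (suc k₁) t₁ (toℕ s) (v# ÷ 3 ^ k₂))
            ≡⟨ cong (λ v → dispatch₁# (valueAt (suc q₁) (suc k₁) t₁ (toℕ s) v)) first ⟩
          dispatch₁# (valueAt (suc q₁) (suc k₁) t₁ (toℕ s) (symbols (lookup vec₁)))
            ≡⟨ cong dispatch₁# (valueAt-toδ t₁ s vec₁) ⟩
          dispatch₁# (actionCode (toδ t₁ s vec₁))
            ≡⟨ response₁# (toδ t₁ s vec₁) ⟩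
          response (δᵈ (run₁ s) v) ∎
        dispatcher#-correct (run₂ s) = begin
          dispatcher# (2 + toℕ (suc q₁ ↑ʳ s)) v#
            ≡⟨ cong (λ s → dispatcher# (2 + s) v#) (toℕ-↑ʳ (suc q₁) s) ⟩
          dispatcher# (2 + (suc q₁ + toℕ s)) v#
            ≡⟨ if0-≥ (suc q₁) (toℕ s) _ _ ⟩
          dispatch₂# (valueAt (suc q₂) (suc k₂) t₂ (suc q₁ + toℕ s ∸ suc q₁) ((v# ÷ 3 ^ dispatchTapes) * 3 ^ k₂ + v# mod′ 3 ^ k₂))
            ≡⟨ cong₂ (λ s v → dispatch₂# (valueAt (suc q₂) (suc k₂) t₂ s v)) (m+n∸m≡n (suc q₁) (toℕ s)) second ⟩
          dispatch₂# (valueAt (suc q₂) (suc k₂) t₂ (toℕ s) (symbols (lookup vec₂)))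
            ≡⟨ cong dispatch₂# (valueAt-toδ t₂ s vec₂) ⟩
          dispatch₂# (actionCode (toδ t₂ s vec₂))
            ≡⟨ response₂# (toδ t₂ s vec₂) ⟩
          response (δᵈ (run₂ s) v) ∎

    dispatch-realized : Realizes dispatcher dispatchTransducer
    dispatch-realized = record
      { code            = stateCode
      ; code-start      = refl
      ; toWork          = toW
      ; fromWork        = fromW
      ; toWork-fromWork = splitAt-join k₁ k₂
      ; δ-code          = λ s vec → toδ-table dispatcher# (stateCode s) vec _ (dispatcher#-correct vec s)
      }

pattern #6 = suc #5
pattern #7 = suc #6
pattern #8 = suc #7

-- Recursiveness of the codes

valueCodeᴿ : Rec n → Rec n → Rec n → Rec n → Rec n
valueCodeᴿ K p w e = sucᴿ ((p ⊗ lit 9 ^ᴿ K ⊕ w) ⊗ lit 3 ⊕ e)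

nextOfᴿ actsOfᴿ : Rec n → Rec n → Rec n
nextOfᴿ K x = (predᴿ x ⊘ lit 3) ⊘ lit 9 ^ᴿ K
actsOfᴿ K x = (predᴿ x ⊘ lit 3) ⊙ lit 9 ^ᴿ K

emitOfᴿ : Rec n → Rec n
emitOfᴿ x = predᴿ x ⊙ lit 3

#valuesᴿ #argumentsᴿ : Rec n → Rec n → Rec n
#valuesᴿ q k    = sucᴿ (q ⊗ (lit 9 ^ᴿ k ⊗ lit 3))
#argumentsᴿ q k = q ⊗ lit 3 ^ᴿ k

digitᴿ : Rec n → Rec n → Rec n → Rec n → Rec n
digitᴿ B K I X = app (withFun (λ { (b ∷ k ∷ i ∷ x ∷ []) → digit b k i x })
  ((var #3 ⊙ (var #0 ^ᴿ (var #1 ⊖ var #2))) ⊘ (var #0 ^ᴿ (var #1 ⊖ sucᴿ (var #2))))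
  (λ { (b ∷ k ∷ i ∷ x ∷ []) → refl })) (B ∷ K ∷ I ∷ X ∷ [])

valueAtᴿ : Rec n → Rec n → Rec n → Rec n → Rec n → Rec n
valueAtᴿ M K T S V = app (withFun (λ { (m ∷ k ∷ t ∷ s ∷ v ∷ []) → valueAt m k t s v })
  (digitᴿ (#valuesᴿ (var #0) (var #1)) (#argumentsᴿ (var #0) (var #1)) (var #3 ⊗ lit 3 ^ᴿ var #1 ⊕ var #4)
    (var #2 ⊙ #valuesᴿ (var #0) (var #1) ^ᴿ #argumentsᴿ (var #0) (var #1)))
  (λ { (m ∷ k ∷ t ∷ s ∷ v ∷ []) → refl })) (M ∷ K ∷ T ∷ S ∷ V ∷ [])

module _ {n} (q₁ k₁ t₁ q₂ k₂ t₂ : Rec n) where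

  sequenceStatesᴿ sequenceTapesᴿ : Rec n
  sequenceStatesᴿ = q₁ ⊕ sucᴿ (sucᴿ q₂)
  sequenceTapesᴿ  = k₁ ⊕ sucᴿ k₂

  sequence₁ᴿ : Rec n → Rec n
  sequence₁ᴿ x = ifᴿ x
    (valueCodeᴿ (sucᴿ sequenceTapesᴿ) (sucᴿ q₁) (lit 0) (lit 0))
    (valueCodeᴿ (sucᴿ sequenceTapesᴿ) (nextOfᴿ (sucᴿ k₁) x)
      (actsOfᴿ (sucᴿ k₁) x ⊗ lit 9 ^ᴿ sucᴿ k₂ ⊕ ifᴿ (emitOfᴿ x) (lit 1) (emitOfᴿ x ⊗ lit 3 ⊕ lit 2) ⊗ lit 9 ^ᴿ k₂)
      (lit 0))

  sequenceᵣᴿ : Rec n → Rec n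
  sequenceᵣᴿ a = ifᴿ a
    (valueCodeᴿ (sucᴿ sequenceTapesᴿ) (sucᴿ (sucᴿ q₁)) (lit 2 ⊗ lit 9 ^ᴿ k₂) (lit 0))
    (valueCodeᴿ (sucᴿ sequenceTapesᴿ) (sucᴿ q₁) (a ⊗ lit 3 ⊗ lit 9 ^ᴿ k₂) (lit 0))

  sequence₂ᴿ : Rec n → Rec n
  sequence₂ᴿ x = ifᴿ x
    (lit 0)
    (valueCodeᴿ (sucᴿ sequenceTapesᴿ) (sucᴿ (sucᴿ q₁) ⊕ nextOfᴿ (sucᴿ k₂) x) (actsOfᴿ (sucᴿ k₂) x) (emitOfᴿ x))

  sequenceᴿ : Rec n → Rec n → Rec n
  sequenceᴿ s v =
    ifᴿ (sucᴿ s ⊖ sucᴿ q₁) (sequence₁ᴿ (valueAtᴿ (sucᴿ q₁) (sucᴿ k₁) t₁ s (v ⊘ lit 3 ^ᴿ sucᴿ k₂))) $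
    ifᴿ (s ⊖ sucᴿ q₁) (sequenceᵣᴿ ((v ⊙ lit 3 ^ᴿ sucᴿ k₂) ⊘ lit 3 ^ᴿ k₂)) $
    sequence₂ᴿ (valueAtᴿ (sucᴿ q₂) (sucᴿ k₂) t₂ (s ⊖ sucᴿ (sucᴿ q₁)) (v ⊙ lit 3 ^ᴿ sucᴿ k₂))

sequenceEntryᴿ : Rec 8
sequenceEntryᴿ = withFun (λ { (s ∷ v ∷ q₁ ∷ k₁ ∷ t₁ ∷ q₂ ∷ k₂ ∷ t₂ ∷ []) → sequence# q₁ k₁ t₁ q₂ k₂ t₂ s v })
  (sequenceᴿ (var #2) (var #3) (var #4) (var #5) (var #6) (var #7) (var #0) (var #1))
  (λ { (s ∷ v ∷ q₁ ∷ k₁ ∷ t₁ ∷ q₂ ∷ k₂ ∷ t₂ ∷ []) → refl })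

transducerCodeᴿ : Rec n → Rec n → Rec n → Rec n
transducerCodeᴿ q k t = pairᴿ (pairᴿ q k) t

sequenceCode₆ : (q₁ k₁ t₁ q₂ k₂ t₂ : ℕ) → ℕ
sequenceCode₆ q₁ k₁ t₁ q₂ k₂ t₂ = transducerCode (sequenceStates q₁ k₁ t₁ q₂ k₂ t₂) (sequenceTapes q₁ k₁ t₁ q₂ k₂ t₂)
  (table (suc (sequenceStates q₁ k₁ t₁ q₂ k₂ t₂)) (suc (sequenceTapes q₁ k₁ t₁ q₂ k₂ t₂)) (sequence# q₁ k₁ t₁ q₂ k₂ t₂))

-- Assembled piece by piece like `sequenceCode₆`, so that the two agree by computation. As in
-- `table`, quotient and remainder of the digit index give state and symbols; that index occupies
-- `var #0`, which shifts the parameters by one.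
sequenceCodeᴿ : Rec n → Rec n → Rec n → Rec n → Rec n → Rec n → Rec n
sequenceCodeᴿ Q₁ K₁ T₁ Q₂ K₂ T₂ = app (withFun
  (λ { (q₁ ∷ k₁ ∷ t₁ ∷ q₂ ∷ k₂ ∷ t₂ ∷ []) →
       sequenceCode₆ q₁ k₁ t₁ q₂ k₂ t₂ })
  (transducerCodeᴿ Q K (hornerᴿ (#valuesᴿ (sucᴿ Q) (sucᴿ K))
    (app sequenceEntryᴿ ((var #0 ⊘ lit 3 ^ᴿ K′) ∷ (var #0 ⊙ lit 3 ^ᴿ K′) ∷
      var #1 ∷ var #2 ∷ var #3 ∷ var #4 ∷ var #5 ∷ var #6 ∷ []))
    (#argumentsᴿ (sucᴿ Q) (sucᴿ K))))
  (λ { (q₁ ∷ k₁ ∷ t₁ ∷ q₂ ∷ k₂ ∷ t₂ ∷ []) → refl }))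
  (Q₁ ∷ K₁ ∷ T₁ ∷ Q₂ ∷ K₂ ∷ T₂ ∷ [])
  where
  Q K : Rec 6
  Q = sequenceStatesᴿ (var #0) (var #1) (var #2) (var #3) (var #4) (var #5)
  K = sequenceTapesᴿ (var #0) (var #1) (var #2) (var #3) (var #4) (var #5)

  K′ : Rec 7
  K′ = sucᴿ (sequenceTapesᴿ (var #1) (var #2) (var #3) (var #4) (var #5) (var #6))

module _ {n} (paired q₁ k₁ t₁ q₂ k₂ t₂ : Rec n) where

  dispatchStatesᴿ dispatchTapesᴿ : Rec n
  dispatchStatesᴿ = lit 1 ⊕ (sucᴿ q₁ ⊕ sucᴿ q₂)
  dispatchTapesᴿ  = k₁ ⊕ k₂

  consumeᴿ : Rec n → Rec n → Rec n
  consumeᴿ s e = valueCodeᴿ (sucᴿ dispatchTapesᴿ) s (lit 2 ⊗ lit 9 ^ᴿ dispatchTapesᴿ) e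

  onSeenᴿ onSeen1ᴿ dispatch₁ᴿ dispatch₂ᴿ : Rec n → Rec n
  onSeenᴿ a = ifᴿ a
    (ifᴿ paired (consumeᴿ (lit 2) (lit 0)) (lit 0))
    (ifᴿ (predᴿ a)
      (consumeᴿ (lit 2) paired)
      (ifᴿ paired (consumeᴿ (lit 2 ⊕ sucᴿ q₁) (lit 0)) (consumeᴿ (lit 1) (lit 2))))
  onSeen1ᴿ a = ifᴿ a (lit 0) (consumeᴿ (lit 0) a)
  dispatch₁ᴿ x = ifᴿ x
    (lit 0)
    (valueCodeᴿ (sucᴿ dispatchTapesᴿ) (lit 2 ⊕ nextOfᴿ (sucᴿ k₁) x) (actsOfᴿ (sucᴿ k₁) x ⊗ lit 9 ^ᴿ k₂) (emitOfᴿ x))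
  dispatch₂ᴿ x = ifᴿ x
    (lit 0)
    (valueCodeᴿ (sucᴿ dispatchTapesᴿ) (lit 2 ⊕ (sucᴿ q₁ ⊕ nextOfᴿ (sucᴿ k₂) x))
      (actsOfᴿ (sucᴿ k₂) x ⊘ lit 9 ^ᴿ k₂ ⊗ lit 9 ^ᴿ dispatchTapesᴿ ⊕ actsOfᴿ (sucᴿ k₂) x ⊙ lit 9 ^ᴿ k₂) (emitOfᴿ x))

  dispatcherᴿ : Rec n → Rec n → Rec n
  dispatcherᴿ s v =
    ifᴿ s           (onSeenᴿ (v ⊘ lit 3 ^ᴿ dispatchTapesᴿ)) $
    ifᴿ (s ⊖ lit 1) (onSeen1ᴿ (v ⊘ lit 3 ^ᴿ dispatchTapesᴿ)) $
    ifᴿ (s ⊖ lit 1 ⊖ sucᴿ q₁)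
      (dispatch₁ᴿ (valueAtᴿ (sucᴿ q₁) (sucᴿ k₁) t₁ (s ⊖ lit 2) (v ⊘ lit 3 ^ᴿ k₂)))
      (dispatch₂ᴿ (valueAtᴿ (sucᴿ q₂) (sucᴿ k₂) t₂ (s ⊖ lit 2 ⊖ sucᴿ q₁)
        (v ⊘ lit 3 ^ᴿ dispatchTapesᴿ ⊗ lit 3 ^ᴿ k₂ ⊕ v ⊙ lit 3 ^ᴿ k₂)))

dispatchEntryᴿ : Rec 9
dispatchEntryᴿ = withFun (λ { (s ∷ v ∷ z ∷ q₁ ∷ k₁ ∷ t₁ ∷ q₂ ∷ k₂ ∷ t₂ ∷ []) → dispatcher# z q₁ k₁ t₁ q₂ k₂ t₂ s v })
  (dispatcherᴿ (var #2) (var #3) (var #4) (var #5) (var #6) (var #7) (var #8) (var #0) (var #1))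
  (λ { (s ∷ v ∷ z ∷ q₁ ∷ k₁ ∷ t₁ ∷ q₂ ∷ k₂ ∷ t₂ ∷ []) → refl })

dispatchCode₇ : (z q₁ k₁ t₁ q₂ k₂ t₂ : ℕ) → ℕ
dispatchCode₇ z q₁ k₁ t₁ q₂ k₂ t₂ = transducerCode (dispatchStates z q₁ k₁ t₁ q₂ k₂ t₂) (dispatchTapes z q₁ k₁ t₁ q₂ k₂ t₂)
  (table (suc (dispatchStates z q₁ k₁ t₁ q₂ k₂ t₂)) (suc (dispatchTapes z q₁ k₁ t₁ q₂ k₂ t₂)) (dispatcher# z q₁ k₁ t₁ q₂ k₂ t₂))

dispatchCodeᴿ : Rec n → Rec n → Rec n → Rec n → Rec n → Rec n → Rec n → Rec n
dispatchCodeᴿ Z Q₁ K₁ T₁ Q₂ K₂ T₂ = app (withFun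
  (λ { (z ∷ q₁ ∷ k₁ ∷ t₁ ∷ q₂ ∷ k₂ ∷ t₂ ∷ []) →
       dispatchCode₇ z q₁ k₁ t₁ q₂ k₂ t₂ })
  (transducerCodeᴿ Q K (hornerᴿ (#valuesᴿ (sucᴿ Q) (sucᴿ K))
    (app dispatchEntryᴿ ((var #0 ⊘ lit 3 ^ᴿ K′) ∷ (var #0 ⊙ lit 3 ^ᴿ K′) ∷
      var #1 ∷ var #2 ∷ var #3 ∷ var #4 ∷ var #5 ∷ var #6 ∷ var #7 ∷ []))
    (#argumentsᴿ (sucᴿ Q) (sucᴿ K))))
  (λ { (z ∷ q₁ ∷ k₁ ∷ t₁ ∷ q₂ ∷ k₂ ∷ t₂ ∷ []) → refl }))
  (Z ∷ Q₁ ∷ K₁ ∷ T₁ ∷ Q₂ ∷ K₂ ∷ T₂ ∷ [])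
  where
  Q K : Rec 7
  Q = dispatchStatesᴿ (var #0) (var #1) (var #2) (var #3) (var #4) (var #5) (var #6)
  K = dispatchTapesᴿ (var #0) (var #1) (var #2) (var #3) (var #4) (var #5) (var #6)

  K′ : Rec 8
  K′ = sucᴿ (dispatchTapesᴿ (var #1) (var #2) (var #3) (var #4) (var #5) (var #6) (var #7))

extraStatesOf extraTapesOf tableOf : ℕ → ℕ
extraStatesOf c = proj₁ (unpair (proj₁ (unpair c)))
extraTapesOf c = proj₂ (unpair (proj₁ (unpair c)))
tableOf c  = proj₂ (unpair c)

extraStatesOfᴿ extraTapesOfᴿ tableOfᴿ : Rec n → Rec n
extraStatesOfᴿ C = fstᴿ (fstᴿ C)
extraTapesOfᴿ C  = sndᴿ (fstᴿ C)
tableOfᴿ C  = sndᴿ C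

opaque
  sequenceCode : ℕ → ℕ → ℕ
  sequenceCode c₁ c₂ = sequenceCode₆ (extraStatesOf c₁) (extraTapesOf c₁) (tableOf c₁) (extraStatesOf c₂) (extraTapesOf c₂) (tableOf c₂)

  dispatchCode : ℕ → ℕ → ℕ → ℕ
  dispatchCode p c₁ c₂ = dispatchCode₇ p (extraStatesOf c₁) (extraTapesOf c₁) (tableOf c₁) (extraStatesOf c₂) (extraTapesOf c₂) (tableOf c₂)

sequenceBodyᴿ : Rec 2
sequenceBodyᴿ = sequenceCodeᴿ
  (extraStatesOfᴿ (var #0)) (extraTapesOfᴿ (var #0)) (tableOfᴿ (var #0))
  (extraStatesOfᴿ (var #1)) (extraTapesOfᴿ (var #1)) (tableOfᴿ (var #1))

dispatchBodyᴿ : Rec 3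
dispatchBodyᴿ = dispatchCodeᴿ (var #0)
  (extraStatesOfᴿ (var #1)) (extraTapesOfᴿ (var #1)) (tableOfᴿ (var #1))
  (extraStatesOfᴿ (var #2)) (extraTapesOfᴿ (var #2)) (tableOfᴿ (var #2))

opaque
  unfolding sequenceCode dispatchCode

  fun-sequenceBodyᴿ : ∀ c₁ c₂ → fun sequenceBodyᴿ (c₁ ∷ c₂ ∷ []) ≡ sequenceCode c₁ c₂
  fun-sequenceBodyᴿ c₁ c₂ = refl

  fun-dispatchBodyᴿ : ∀ p c₁ c₂ → fun dispatchBodyᴿ (p ∷ c₁ ∷ c₂ ∷ []) ≡ dispatchCode p c₁ c₂
  fun-dispatchBodyᴿ p c₁ c₂ = refl

composeᴿ : Rec n → Rec n → Rec n
composeᴿ C₁ C₂ = app (withFun (λ { (c₁ ∷ c₂ ∷ []) → sequenceCode c₁ c₂ }) sequenceBodyᴿ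
  (λ { (c₁ ∷ c₂ ∷ []) → fun-sequenceBodyᴿ c₁ c₂ })) (C₁ ∷ C₂ ∷ [])

dispatchByᴿ : Rec n → Rec n → Rec n → Rec n
dispatchByᴿ P C₁ C₂ = app (withFun (λ { (p ∷ c₁ ∷ c₂ ∷ []) → dispatchCode p c₁ c₂ }) dispatchBodyᴿ
  (λ { (p ∷ c₁ ∷ c₂ ∷ []) → fun-dispatchBodyᴿ p c₁ c₂ })) (P ∷ C₁ ∷ C₂ ∷ [])

-- What the computed codes compute

infix 4 _codes_

record _codes_ (c : ℕ) (f : Word → Word) : Set where
  constructor coded
  field
    computed : ComputesInPolyTime (toTransducer c) f
open _codes_

transducerCode-codes : ∀ q k t {f} → ComputesInPolyTime (transducer q k (toδ t)) f → transducerCode q k t codes f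
transducerCode-codes q k t {f} C =
  coded (subst (λ M → ComputesInPolyTime M f) (sym (toTransducer-transducerCode q k t)) C)

module _ (q₁ k₁ t₁ q₂ k₂ t₂ : ℕ) where
  private
    M₁ M₂ : Machine
    M₁ = machine (transducer q₁ k₁ (toδ t₁))
    M₂ = machine (transducer q₂ k₂ (toδ t₂))

  sequenceCode₆-codes : ∀ {p f} → Computes (Sequence.sequence M₁ M₂) p f → sequenceCode₆ q₁ k₁ t₁ q₂ k₂ t₂ codes f
  sequenceCode₆-codes {p} {f} C = transducerCode-codes
    (sequenceStates q₁ k₁ t₁ q₂ k₂ t₂) (sequenceTapes q₁ k₁ t₁ q₂ k₂ t₂)
    (table (suc (sequenceStates q₁ k₁ t₁ q₂ k₂ t₂)) (suc (sequenceTapes q₁ k₁ t₁ q₂ k₂ t₂)) (sequence# q₁ k₁ t₁ q₂ k₂ t₂))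
    (realizes-computes (Sequence.sequence M₁ M₂) (sequenceTransducer q₁ k₁ t₁ q₂ k₂ t₂)
      (sequence-realized q₁ k₁ t₁ q₂ k₂ t₂) {p} C)

  dispatchCode₇-codes : ∀ paired {z} → z ≡ (if paired then 1 else 0) → ∀ {p f} →
    Computes (Dispatch.dispatcher paired M₁ M₂) p f → dispatchCode₇ z q₁ k₁ t₁ q₂ k₂ t₂ codes f
  dispatchCode₇-codes paired {z} z≡ {p} {f} C = transducerCode-codes
    (dispatchStates z q₁ k₁ t₁ q₂ k₂ t₂) (dispatchTapes z q₁ k₁ t₁ q₂ k₂ t₂)
    (table (suc (dispatchStates z q₁ k₁ t₁ q₂ k₂ t₂)) (suc (dispatchTapes z q₁ k₁ t₁ q₂ k₂ t₂)) (dispatcher# z q₁ k₁ t₁ q₂ k₂ t₂))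
    (realizes-computes (Dispatch.dispatcher paired M₁ M₂) (dispatchTransducer z q₁ k₁ t₁ q₂ k₂ t₂)
      (dispatch-realized z q₁ k₁ t₁ q₂ k₂ t₂ paired z≡) {p} C)

opaque
  unfolding sequenceCode dispatchCode

  sequenceCode-codes : ∀ {c₁ c₂ f₁ f₂} → c₁ codes f₁ → c₂ codes f₂ → sequenceCode c₁ c₂ codes f₂ ∘ f₁
  sequenceCode-codes {c₁} {c₂} {f₁} {f₂} (coded C₁) (coded C₂) =
    let p₁ , D₁ = machine-computes (toTransducer c₁) C₁
        p₂ , D₂ = machine-computes (toTransducer c₂) C₂
    in sequenceCode₆-codes (extraStatesOf c₁) (extraTapesOf c₁) (tableOf c₁) (extraStatesOf c₂) (extraTapesOf c₂) (tableOf c₂)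
         {Sequence.sequenceᴾ (machine (toTransducer c₁)) (machine (toTransducer c₂)) p₁ p₂}
         (Sequence.sequence-computes (machine (toTransducer c₁)) (machine (toTransducer c₂)) {p₁} {p₂} D₁ D₂)

  -- The dispatcher has two components by construction; in the paired case the second is never
  -- started, and `c` fills its place.
  dispatchCode-codes-onSecond : ∀ {c f} → c codes f → dispatchCode 1 c c codes onSecond f
  dispatchCode-codes-onSecond {c} {f} (coded C) =
    let p , D = machine-computes (toTransducer c) C
    in dispatchCode₇-codes (extraStatesOf c) (extraTapesOf c) (tableOf c) (extraStatesOf c) (extraTapesOf c) (tableOf c)
         true refl {idᴾ +ᴾ p} (paired-computes (machine (toTransducer c)) (machine (toTransducer c)) {p} D)

  dispatchCode-codes-union : ∀ {c₁ c₂ f₁ f₂} → c₁ codes f₁ → c₂ codes f₂ → dispatchCode 0 c₁ c₂ codes union f₁ f₂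
  dispatchCode-codes-union {c₁} {c₂} {f₁} {f₂} (coded C₁) (coded C₂) =
    let p₁ , D₁ = machine-computes (toTransducer c₁) C₁
        p₂ , D₂ = machine-computes (toTransducer c₂) C₂
    in dispatchCode₇-codes (extraStatesOf c₁) (extraTapesOf c₁) (tableOf c₁) (extraStatesOf c₂) (extraTapesOf c₂) (tableOf c₂)
         false refl {constᴾ 1 +ᴾ (p₁ +ᴾ p₂)}
         (union-computes (machine (toTransducer c₁)) (machine (toTransducer c₂)) {p₁} {p₂} D₁ D₂)

opaque
  -- Meant for `r` and the checker, which do not vary with `a`: some code suffices, entering the
  -- jump operator as a constant. The enumeration reaches a transition function only up to pointwise
  -- equality, which `Realizes` tolerates.
  PolyTimeComputable⇒coded : ∀ {f} → PolyTimeComputable f → ∃[ c ] c codes f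
  PolyTimeComputable⇒coded {f} (M@(transducer q k δ₀) , C) =
    let c , t , c≡ , t≡ = toTransducer-surjective q k δ₀
        p , D = machine-computes M C
    in c , coded (subst (λ N → ComputesInPolyTime N f) (sym c≡) (realizes-computes (machine M) _ (record
         { code            = id
         ; code-start      = refl
         ; toWork          = id
         ; fromWork        = id
         ; toWork-fromWork = λ _ → refl
         ; δ-code          = λ s v → begin
             toδ t s v                                       ≡⟨ t≡ s v ⟩
             δ₀ s v                                          ≡⟨ map-id (δ₀ s v) ⟨
             Maybe.map id (δ₀ s v)                           ≡⟨ map-cong rebuilt (δ₀ s v) ⟨
             Maybe.map (rebuild ∘ respond M) (δ₀ s v)        ≡⟨ map-∘ (δ₀ s v) ⟩
             Maybe.map rebuild (Maybe.map (respond M) (δ₀ s v))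
               ≡⟨ cong (Maybe.map rebuild ∘ Maybe.map (respond M) ∘ δ₀ s) (reread v) ⟨
             Maybe.map rebuild (δ (machine M) s (lookup v ∘ pos)) ∎
         }) {p} D))
    where
    open ≡-Reasoning
    rebuild : Response (Fin (suc q)) (Fin k) → Action (suc q) (suc k)
    rebuild (s , w , e) = action s (tabulate (w ∘ idx)) e

    reread : ∀ {A : Set} (v : Vec A (suc k)) → tabulate (lookup v ∘ pos ∘ idx) ≡ v
    reread v = trans (tabulate-cong (cong (lookup v) ∘ pos-idx)) (tabulate∘lookup v)

    rebuilt : ∀ α → rebuild (respond M α) ≡ α
    rebuilt (action s w e) = cong (λ w → action s w e) (reread w)

-- The comparison machine as a transducer

module _ (M : Transducer) (default : Word) where
  open Transducer M using (extraStates; extraTapes)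
  open Check (machine M) default
  private
    stateCode : S → Fin (4 + (suc extraStates + suc (length default)))
    stateCode parse       = zero
    stateCode parse₁      = suc zero
    stateCode rewind      = suc (suc zero)
    stateCode emitting    = suc (suc (suc zero))
    stateCode (run s)     = suc (suc (suc (suc (s ↑ˡ suc (length default)))))
    stateCode (failing i) = suc (suc (suc (suc (suc extraStates ↑ʳ i))))

    toState : Fin (4 + (suc extraStates + suc (length default))) → S
    toState zero                      = parse
    toState (suc zero)                = parse₁
    toState (suc (suc zero))          = rewind
    toState (suc (suc (suc zero)))    = emitting
    toState (suc (suc (suc (suc i)))) = [ run , failing ]′ (splitAt (suc extraStates) i)

    toState-stateCode : ∀ s → toState (stateCode s) ≡ s
    toState-stateCode parse       = refl
    toState-stateCode parse₁      = refl
    toState-stateCode rewind      = refl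
    toState-stateCode emitting    = refl
    toState-stateCode (run s)     = cong [ run , failing ]′ (splitAt-↑ˡ (suc extraStates) s (suc (length default)))
    toState-stateCode (failing i) = cong [ run , failing ]′ (splitAt-↑ʳ (suc extraStates) (suc (length default)) i)

    encode : Response S W → Action (4 + (suc extraStates + suc (length default))) (3 + extraTapes)
    encode (s , w , e) = action (stateCode s) (tabulate (w ∘ tapeAt (tapeAt idx))) e

  checkTransducer : Transducer
  checkTransducer = transducer (3 + (suc extraStates + suc (length default))) (2 + extraTapes)
    λ i v → Maybe.map encode (δᶜ (toState i) (lookup v ∘ position (position pos)))

  check-realized : Realizes checker checkTransducer
  check-realized = record
    { code            = stateCode
    ; code-start      = refl
    ; toWork          = tapeAt idx
    ; fromWork        = position pos
    ; toWork-fromWork = tapeAt-position (tapeAt-position (λ _ → refl))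
    ; δ-code          = λ s v → cong (λ s → Maybe.map encode (δᶜ s (lookup v ∘ position (position pos)))) (toState-stateCode s)
    }

check-polyTime : ∀ {r} default → PolyTimeComputable r → PolyTimeComputable (CheckFunction.check r default [])
check-polyTime {r} default (M , C) = let p , D = machine-computes M C in
  checkTransducer M default ,
  realizes-computes _ _ (check-realized M default) {Check.checkerᴾ (machine M) default {p} D}
    (Check.checker-computes (machine M) default {p} D)

-- For the simulation argument: the translated proof of `h x` contains `h x` itself and must stay
-- polynomially short.
output-bound : ∀ {c f} → c codes f → ∃[ p ] ∀ x → length (f x) ≤ ⟦ p ⟧ (length x)
output-bound {c} (coded C) = let p , D = machine-computes (toTransducer c) C in
  p , λ x → output-length (D x (λ { nothing → at [] x ; (just _) → emptyTape }) (starting ≈-refl (λ _ → ≈-refl)))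

-- The pulled back proof system

pairing : Word → Word → Word
pairing []      w = false ∷ w
pairing (b ∷ u) w = true ∷ b ∷ pairing u w

onSecond-pairing : ∀ f u w → onSecond f (pairing u w) ≡ pairing u (f w)
onSecond-pairing f []      w = refl
onSecond-pairing f (b ∷ u) w = cong (λ x → true ∷ b ∷ x) (onSecond-pairing f u w)

length-pairing : ∀ u w → length (pairing u w) ≡ suc (length u + length u + length w)
length-pairing []      w = refl
length-pairing (b ∷ u) w = cong suc (trans (cong suc (length-pairing u w))
  (cong (λ n → suc (n + length w)) (sym (+-suc (length u) (length u)))))

module _ (r : Word → Word) (default : Word) where
  open CheckFunction r default

  -- Parsing pushes the claim in reverse onto `l`, and `check` reverses it back; for `l = []` the
  -- double reversal is `u`.
  check-pairing : ∀ l u v → let x = (u ʳ++ l) ʳ++ [] in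
    check l (pairing u v) ≡ (if r x ≡ᵇʷ v then x else default)
  check-pairing l []      v = refl
  check-pairing l (b ∷ u) v = check-pairing (b ∷ l) u v

  check-accepts : ∀ u → check [] (pairing u (r u)) ≡ u
  check-accepts u = trans (check-pairing [] u (r u))
    (trans (cong (λ x → if r x ≡ᵇʷ r u then x else default) (reverse-involutive u))
      (cong (λ c → if c then u else default) (≡ᵇʷ-refl (r u))))

  module _ {a b} {A : Pred Word a} {B : Pred Word b} {f : Word → Word}
    (default∈A : default ∈ A) (f∈B : ∀ w → f w ∈ B) (reflects : ∀ u → r u ∈ B → u ∈ A) where

    -- Soundness on every input, well formed or not: a claim is output only if its image under `r`
    -- equals a value of `f`, which lies in `B`; otherwise the output is the default.
    check-onSecond∈A : ∀ l x → check l (onSecond f x) ∈ A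
    check-onSecond∈A l []             = default∈A
    check-onSecond∈A l (false ∷ x) with r (l ʳ++ []) ≡ᵇʷ f x in eq
    ... | true  = reflects (l ʳ++ []) (subst (_∈ B) (sym (≡ᵇʷ-sound (r (l ʳ++ [])) (f x) eq)) (f∈B x))
    ... | false = default∈A
    check-onSecond∈A l (true ∷ [])    = default∈A
    check-onSecond∈A l (true ∷ b ∷ x) = check-onSecond∈A (b ∷ l) x

-- The jump operator for `B`

theorem1 : ∀ {a b : Level} (A : Pred Word a) (B : Pred Word b) →
    Satisfiable A → HasRecursiveJumpOperator A → A ≤ₘᵖ B →
    HasRecursiveJumpOperator B
theorem1 A B (a₀ , a₀∈A) (J , (φ , φ-computes-J) , J-jumps) (r , r-polyTime , r-reduces) =
  (λ a → positive (nextCode (pred (value a)))) , (index jump , λ a → computes jump (value a ∷ [])) , jumps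
  where
  open CheckFunction r a₀

  -- `P` decodes the predecessor of its argument, so `P (positive c)` reduces to `toTransducer c`.
  -- All constructions work with such codes counted from 0.
  positive : ℕ → ℕ⁺
  positive c = suc c , [ nonZero ]

  r-code check-code : ℕ
  r-code     = proj₁ (PolyTimeComputable⇒coded r-polyTime)
  check-code = proj₁ (PolyTimeComputable⇒coded (check-polyTime a₀ r-polyTime))

  -- `φ` expects a positive code, hence the successor before it; its value is positive again, and
  -- `jump` takes the predecessor.
  given : Rec n → Rec n
  given C = app (rec (λ { (c ∷ []) → value (J (positive c)) }) (comp φ (sucᶠ ∷ []))
    (λ { (c ∷ []) → comp (sucᶠ ∷ []) (φ-computes-J (positive c)) })) (C ∷ [])

  pullbackCode : ℕ → ℕ
  pullbackCode c = sequenceCode (dispatchCode 1 c c) check-code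

  nextCode : ℕ → ℕ
  nextCode c = dispatchCode 0 c (sequenceCode (pred (value (J (positive (pullbackCode c))))) r-code)

  jump : Rec 1
  jump = withFun (λ { (a ∷ []) → suc (nextCode (pred a)) })
    (sucᴿ (dispatchByᴿ (lit 0) c (composeᴿ (predᴿ (given (composeᴿ (dispatchByᴿ (lit 1) c c) (lit check-code)))) (lit r-code))))
    (λ { (a ∷ []) → refl })
    where
    c : Rec 1
    c = predᴿ (var zero)

  jumps : IsJumpOperator B (λ a → positive (nextCode (pred (value a))))
  jumps a f (f-computed , f-range) = g , (computed g-coded , g-range) , not-simulated
    where
    open Equivalence

    c : ℕ
    c = pred (value a)

    f∈B : ∀ w → f w ∈ B
    f∈B w = from (f-range (f w)) (w , refl)

    pullback : Word → Word
    pullback = check [] ∘ onSecond f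

    pullback-coded : pullbackCode c codes pullback
    pullback-coded = sequenceCode-codes {dispatchCode 1 c c}
      (dispatchCode-codes-onSecond {c} (coded f-computed))
      (proj₂ (PolyTimeComputable⇒coded (check-polyTime a₀ r-polyTime)))

    pullback-pairing : ∀ u w → f w ≡ r u → pullback (pairing u w) ≡ u
    pullback-pairing u w fw≡ru = trans
      (cong (check []) (trans (onSecond-pairing f u w) (cong (pairing u) fw≡ru))) (check-accepts r a₀ u)

    -- Completeness: for `u` in `A` the word `r u` lies in `B` and so has an `f`-proof `w`, which is
    -- paired with `u`.
    pullback-range : ∀ u → u ∈ A ⇔ (∃[ x ] pullback x ≡ u)
    pullback-range u = mk⇔
      (λ u∈A → let w , fw≡ru = to (f-range (r u)) (to (r-reduces u) u∈A) in
        pairing u w , pullback-pairing u w fw≡ru)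
      (λ (x , eq) → subst (_∈ A) eq
        (check-onSecond∈A r a₀ {A = A} {B = B} a₀∈A f∈B (λ u → from (r-reduces u)) [] x))

    jumped : ∃[ h ] IsProofSystem A (P (J (positive (pullbackCode c)))) h × _
    jumped = J-jumps (positive (pullbackCode c)) pullback (computed pullback-coded , pullback-range)

    h : Word → Word
    h = proj₁ jumped

    h-coded : pred (value (J (positive (pullbackCode c)))) codes h
    h-coded = coded (proj₁ (proj₁ (proj₂ jumped)))

    h-range : ∀ u → u ∈ A ⇔ (∃[ x ] h x ≡ u)
    h-range = proj₂ (proj₁ (proj₂ jumped))

    g : Word → Word
    g = union f (r ∘ h)

    g-coded : nextCode c codes g
    g-coded = dispatchCode-codes-union {c} (coded f-computed)
      (sequenceCode-codes {pred (value (J (positive (pullbackCode c))))} h-coded (proj₂ (PolyTimeComputable⇒coded r-polyTime)))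

    g∈B : ∀ x → g x ∈ B
    g∈B []          = f∈B []
    g∈B (false ∷ x) = f∈B x
    g∈B (true ∷ x)  = to (r-reduces (h x)) (from (h-range (h x)) (x , refl))

    g-range : ∀ y → y ∈ B ⇔ (∃[ x ] g x ≡ y)
    g-range y = mk⇔ (λ y∈B → let w , fw≡y = to (f-range y) y∈B in false ∷ w , fw≡y)
      (λ (x , eq) → subst (_∈ B) eq (g∈B x))

    -- If π translates g-proofs into f-proofs, then a g-proof of r (h x)
    -- together with h x itself is a proof of h x in the pulled back system.
    not-simulated : ¬ Simulates f g
    not-simulated (π , p , π-simulates) = proj₂ (proj₂ jumped) (π′ , p′ , λ x → π′-short x , pullback-pairing (h x) _ (proj₂ (π-simulates (true ∷ x))))
      where
      π′ : Word → Word
      π′ x = pairing (h x) (π (true ∷ x))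

      q : Polynomial
      q = proj₁ (output-bound h-coded)

      p′ : Polynomial
      -- A pair has length 1 plus twice the first component plus the second. The polynomial
      -- `1 ∷ 1 ∷ []` is `n + 1`, for the tag `true` in front of `x`.
      p′ = constᴾ 1 +ᴾ (q +ᴾ q +ᴾ (p ∘ᴾ (1 ∷ 1 ∷ [])))

      ⟦p′⟧ : ∀ n → ⟦ p′ ⟧ n ≡ suc (⟦ q ⟧ n + ⟦ q ⟧ n + ⟦ p ⟧ (suc n))
      ⟦p′⟧ n = begin
        ⟦ p′ ⟧ n
          ≡⟨ trans (⟦+ᴾ⟧ (constᴾ 1) (q +ᴾ q +ᴾ (p ∘ᴾ (1 ∷ 1 ∷ []))) n) (cong (_+ ⟦ q +ᴾ q +ᴾ (p ∘ᴾ (1 ∷ 1 ∷ [])) ⟧ n) (⟦constᴾ⟧ 1 n)) ⟩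
        suc (⟦ q +ᴾ q +ᴾ (p ∘ᴾ (1 ∷ 1 ∷ [])) ⟧ n)
          ≡⟨ cong suc (⟦+ᴾ⟧ (q +ᴾ q) (p ∘ᴾ (1 ∷ 1 ∷ [])) n) ⟩
        suc (⟦ q +ᴾ q ⟧ n + ⟦ p ∘ᴾ (1 ∷ 1 ∷ []) ⟧ n)
          ≡⟨ cong₂ (λ x y → suc (x + y)) (⟦+ᴾ⟧ q q n) (trans (⟦∘ᴾ⟧ p (1 ∷ 1 ∷ []) n) (cong (λ m → ⟦ p ⟧ (suc m)) (⟦idᴾ⟧ n))) ⟩
        suc (⟦ q ⟧ n + ⟦ q ⟧ n + ⟦ p ⟧ (suc n)) ∎
        where open ≡-Reasoning

      π′-short : ∀ x → length (π′ x) ≤ ⟦ p′ ⟧ (length x)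
      π′-short x = begin
        length (π′ x)
          ≡⟨ length-pairing (h x) (π (true ∷ x)) ⟩
        suc (length (h x) + length (h x) + length (π (true ∷ x)))
          ≤⟨ s≤s (+-mono-≤ (+-mono-≤ h-short h-short) (proj₁ (π-simulates (true ∷ x)))) ⟩
        suc (⟦ q ⟧ (length x) + ⟦ q ⟧ (length x) + ⟦ p ⟧ (suc (length x)))
          ≡⟨ ⟦p′⟧ (length x) ⟨
        ⟦ p′ ⟧ (length x) ∎
        where
        open ≤-Reasoning
        h-short : length (h x) ≤ ⟦ q ⟧ (length x)
        h-short = proj₂ (output-bound h-coded) x
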